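{- Let $G$ be a tree-cograph and let $T$ be a decomposition tree for $G$. Then, when the decomposition tree $T$ is a part of the input, the maximal number of edges in an induced matching in $G$ can be computed in linear time.
   Context: All graphs are finite, simple and undirected. For a graph $G$, $\bar G$ denotes its complement. Tree-cographs are defined recursively: (1) every tree is a tree-cograph; (2) if $G$ is a tree-cograph then its complement $\bar G$ is a tree-cograph; (3) for $k\ge 2$, if $G_1,\ldots,G_k$ are connected tree-cographs then their disjoint union is a tree-cograph. A decomposition tree for a tree-cograph $G$ is a rooted binary tree in which each internal node (including the root) is labeled as a join node $\otimes$ or a union node $\oplus$, and whose leaves are labeled by trees or complements of trees; the graph $G$ is obtained by evaluating this tree bottom-up, where a union node takes the disjoint union of the graphs of its two children and a join node takes their join (the disjoint union together with all edges between the two vertex sets). An induced matching in $G$ is a set of edges, no two of which share an endpoint or are joined by an edge of $G$; equivalently, an independent set in $L(G)^2$, the square of the linegraph $L(G)$ (two distinct vertices of the square $H^2$ of a graph $H$ are adjacent if their distance in $H$ is at most $2$). Linear time means $O(n)$ time, where $n$ is the number of vertices of $G$, the decomposition tree being a part of the input. -}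

module Defs where

open import Data.Nat using (ℕ; zero; suc; _+_; _∸_; _≤_)
import Data.Nat.Properties as ℕ
open import Data.Bool using (if_then_else_)
open import Data.Fin using (Fin; zero; suc; toℕ; fromℕ; inject₁)
import Data.Fin.Properties as Fin
open import Data.List using (List; []; _∷_; _++_; [_]; length; map; concatMap; allFin)
open import Data.List.Membership.Propositional using (_∈_)
open import Data.List.Relation.Unary.All using (All)
open import Data.List.Relation.Unary.AllPairs using (AllPairs)
open import Data.List.Relation.Unary.Unique.Propositional using (Unique)
open import Data.Product using (Σ; ∃; _×_; _,_; uncurry)
open import Data.Sum using (_⊎_; inj₁; inj₂)
open import Data.Sum.Relation.Binary.Pointwise
  using (Pointwise; inj₁; inj₂; ⊎-symmetric; ⊎-decidable)
open import Function using (_∘_)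
open import Function.Bundles using (_↔_; _⇔_; Inverse)
open import Function.Definitions using (Injective)
open import Level using (0ℓ)
open import Relation.Binary.Core using (Rel)
open import Relation.Binary.Definitions using (Decidable; Symmetric)
open import Relation.Binary.Construct.Closure.ReflexiveTransitive using (Star)
open import Relation.Binary.PropositionalEquality using (_≡_; _≢_; refl; sym)
open import Relation.Nullary using (¬_; yes; no; does)
open import Relation.Nullary.Decidable using (¬?; _×-dec_; map′)

-- Simple undirected graphs on V.  Finiteness comes from the choice of V
-- (Fin n, or sums of such types).
record Graph (V : Set) : Set₁ where
  field
    Adj    : Rel V 0ℓ
    adj?   : Decidable Adj
    symm   : Symmetric Adj
    irrefl : ∀ {x} → ¬ Adj x x

open Graph public

record _≅_ {V W : Set} (G : Graph V) (H : Graph W) : Set where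
  field
    bijection : V ↔ W
    preserves : ∀ x y →
      Adj G x y ⇔ Adj H (Inverse.to bijection x) (Inverse.to bijection y)

infix 4 _≅_

∁ : ∀ {n} → Graph (Fin n) → Graph (Fin n)
∁ G = record
  { Adj    = λ x y → x ≢ y × ¬ Adj G x y
  ; adj?   = λ x y → ¬? (x Fin.≟ y) ×-dec ¬? (adj? G x y)
  ; symm   = λ (x≢y , ¬a) → x≢y ∘ sym , ¬a ∘ symm G
  ; irrefl = λ (x≢x , _) → x≢x refl
  }

_⊕_ : ∀ {V W} → Graph V → Graph W → Graph (V ⊎ W)
G ⊕ H = record
  { Adj    = Pointwise (Adj G) (Adj H)
  ; adj?   = ⊎-decidable (adj? G) (adj? H)
  ; symm   = ⊎-symmetric (symm G) (symm H)
  ; irrefl = λ { (inj₁ a) → irrefl G a ; (inj₂ a) → irrefl H a }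
  }

data JoinAdj {V W : Set} (R : Rel V 0ℓ) (S : Rel W 0ℓ) : Rel (V ⊎ W) 0ℓ where
  left   : ∀ {x y} → R x y → JoinAdj R S (inj₁ x) (inj₁ y)
  right  : ∀ {x y} → S x y → JoinAdj R S (inj₂ x) (inj₂ y)
  cross  : ∀ {x y} → JoinAdj R S (inj₁ x) (inj₂ y)
  cross′ : ∀ {x y} → JoinAdj R S (inj₂ x) (inj₁ y)

_⊗_ : ∀ {V W} → Graph V → Graph W → Graph (V ⊎ W)
G ⊗ H = record
  { Adj    = JoinAdj (Adj G) (Adj H)
  ; adj?   = λ { (inj₁ x) (inj₁ y) → map′ left (λ { (left a) → a }) (adj? G x y)
               ; (inj₂ x) (inj₂ y) → map′ right (λ { (right a) → a }) (adj? H x y)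
               ; (inj₁ _) (inj₂ _) → yes cross
               ; (inj₂ _) (inj₁ _) → yes cross′ }
  ; symm   = λ { (left a) → left (symm G a) ; (right a) → right (symm H a)
               ; cross → cross′ ; cross′ → cross }
  ; irrefl = λ { (left a) → irrefl G a ; (right a) → irrefl H a }
  }

data FamilyAdj {k} {V : Fin k → Set} (R : ∀ i → Rel (V i) 0ℓ) :
               Rel (Σ (Fin k) V) 0ℓ where
  same : ∀ {i x y} → R i x y → FamilyAdj R (i , x) (i , y)

⨆ : ∀ {k} {V : Fin k → Set} → (∀ i → Graph (V i)) → Graph (Σ (Fin k) V)
⨆ {k} {V} G = record
  { Adj    = FamilyAdj (λ i → Adj (G i))
  ; adj?   = dec
  ; symm   = λ { (same a) → same (symm (G _) a) }
  ; irrefl = λ { (same a) → irrefl (G _) a }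
  }
  where
  dec : Decidable (FamilyAdj (λ i → Adj (G i)))
  dec (i , x) (j , y) with i Fin.≟ j
  ... | yes refl = map′ same (λ { (same a) → a }) (adj? (G i) x y)
  ... | no i≢j   = no λ { (same _) → i≢j refl }

Connected : ∀ {V} → Graph V → Set
Connected G = ∀ x y → Star (Adj G) x y

record Cycle {V} (G : Graph V) : Set where
  field
    {extra}  : ℕ
    vertex   : Fin (3 + extra) → V
    distinct : Injective _≡_ _≡_ vertex
    step     : ∀ (i : Fin (2 + extra)) → Adj G (vertex (inject₁ i)) (vertex (suc i))
    close    : Adj G (vertex (fromℕ (2 + extra))) (vertex zero)

record IsTree {V} (G : Graph V) : Set where
  field
    nonempty  : V
    connected : Connected G
    acyclic   : ¬ Cycle G

-- The isomorphisms make the class independent of vertex names.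
data TreeCograph {n} (G : Graph (Fin n)) : Set₁ where
  tree       : IsTree G → TreeCograph G
  complement : (H : Graph (Fin n)) → TreeCograph H → G ≅ ∁ H → TreeCograph G
  union      : ∀ {k} → 2 ≤ k →
               (m : Fin k → ℕ) (H : ∀ i → Graph (Fin (m i))) →
               (∀ i → Connected (H i)) → (∀ i → TreeCograph (H i)) →
               G ≅ ⨆ H → TreeCograph G

data LeafKind : Set where
  tree cotree : LeafKind

data NodeKind : Set where
  union join : NodeKind

-- A leaf labelled by the complement of a tree H records H itself, since the
-- complement has quadratically many edges.
data DecompositionTree : Set₁ where
  leaf : LeafKind → ∀ {m} (H : Graph (Fin m)) → IsTree H → DecompositionTree
  node : NodeKind → DecompositionTree → DecompositionTree → DecompositionTree

Vertex : DecompositionTree → Set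
Vertex (leaf _ {m} _ _) = Fin m
Vertex (node _ L R)     = Vertex L ⊎ Vertex R

evaluate : (T : DecompositionTree) → Graph (Vertex T)
evaluate (leaf tree H _)   = H
evaluate (leaf cotree H _) = ∁ H
evaluate (node union L R)  = evaluate L ⊕ evaluate R
evaluate (node join L R)   = evaluate L ⊗ evaluate R

_IsDecompositionOf_ : ∀ {n} → DecompositionTree → Graph (Fin n) → Set
T IsDecompositionOf G = evaluate T ≅ G

Separated : ∀ {V} → Graph V → Rel (V × V) 0ℓ
Separated G (u , v) (x , y) =
  Apart u x × Apart u y × Apart v x × Apart v y
  where
  Apart : Rel _ 0ℓ
  Apart a b = a ≢ b × ¬ Adj G a b

-- Each edge is listed in one of its two orientations; separation rules out
-- repetitions, so the length of the list is the number of edges.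
IsInducedMatching : ∀ {V} → Graph V → List (V × V) → Set
IsInducedMatching G M = All (uncurry (Adj G)) M × AllPairs (Separated G) M

IsMaxInducedMatchingSize : ∀ {V} → Graph V → ℕ → Set
IsMaxInducedMatchingSize G k =
  (∃ λ M → IsInducedMatching G M × length M ≡ k) ×
  (∀ M → IsInducedMatching G M → length M ≤ k)

-- Input: the decomposition tree in postorder, with the tree at a leaf
-- given by adjacency lists whose entries may come in any order.

record AdjacencyLists {m} (H : Graph (Fin m)) : Set where
  field
    neighbours : Fin m → List (Fin m)
    unique     : ∀ v → Unique (neighbours v)
    complete   : ∀ v w → w ∈ neighbours v ⇔ Adj H v w

  word : List ℕ
  word = concatMap (λ v → length (neighbours v) ∷ map toℕ (neighbours v)) (allFin m)

leafTag : LeafKind → ℕ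
leafTag tree   = 0
leafTag cotree = 1

nodeTag : NodeKind → ℕ
nodeTag union = 2
nodeTag join  = 3

data _Encodes_ : List ℕ → DecompositionTree → Set₁ where
  leaf : ∀ κ {m} {H : Graph (Fin m)} {isTree : IsTree H} (A : AdjacencyLists H) →
         (leafTag κ ∷ m ∷ AdjacencyLists.word A) Encodes leaf κ H isTree
  node : ∀ κ {L R u v} → u Encodes L → v Encodes R →
         (u ++ v ++ [ nodeTag κ ]) Encodes node κ L R

-- Random access machine with the uniform cost measure.  Programs are
-- structured; arithmetic is limited to addition and truncated subtraction, and
-- a nonzero value counts as true.

data Expr : Set where
  const     : ℕ → Expr
  reg       : ℕ → Expr
  mem       : Expr → Expr
  _⊞_ _⊟_   : Expr → Expr → Expr

infixl 6 _⊞_ _⊟_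

data Program : Set where
  skip            : Program
  _≔_             : ℕ → Expr → Program
  mem[_]≔_        : Expr → Expr → Program
  _⨟_             : Program → Program → Program
  ifnz_then_else_ : Expr → Program → Program → Program
  whilenz_loop_   : Expr → Program → Program

infixr 4 _⨟_
infix  5 _≔_ mem[_]≔_ ifnz_then_else_ whilenz_loop_

record State : Set where
  constructor ⟨_,_⟩
  field
    registers : ℕ → ℕ
    memory    : ℕ → ℕ

open State public

_[_↦_] : (ℕ → ℕ) → ℕ → ℕ → (ℕ → ℕ)
(f [ a ↦ b ]) i = if does (i ℕ.≟ a) then b else f i

eval : Expr → State → ℕ
eval (const k) s = k
eval (reg r)   s = registers s r
eval (mem e)   s = memory s (eval e s)
eval (e ⊞ e′)  s = eval e s + eval e′ s
eval (e ⊟ e′)  s = eval e s ∸ eval e′ s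

cost : Expr → ℕ
cost (const _) = 1
cost (reg _)   = 1
cost (mem e)   = 1 + cost e
cost (e ⊞ e′)  = 1 + (cost e + cost e′)
cost (e ⊟ e′)  = 1 + (cost e + cost e′)

-- p ∶ s ⇓[ t ] s′ : started in s, the program p halts in s′ after t steps.
data _∶_⇓[_]_ : Program → State → ℕ → State → Set where
  skip : ∀ {s} → skip ∶ s ⇓[ 1 ] s
  assign : ∀ {r e s} →
    (r ≔ e) ∶ s ⇓[ 1 + cost e ] ⟨ registers s [ r ↦ eval e s ] , memory s ⟩
  store : ∀ {a e s} →
    (mem[ a ]≔ e) ∶ s ⇓[ 1 + (cost a + cost e) ]
      ⟨ registers s , memory s [ eval a s ↦ eval e s ] ⟩
  seq : ∀ {p q s s′ s″ t t′} →
    p ∶ s ⇓[ t ] s′ → q ∶ s′ ⇓[ t′ ] s″ → (p ⨟ q) ∶ s ⇓[ t + t′ ] s″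
  if-nonzero : ∀ {e p q s s′ t} → eval e s ≢ 0 →
    p ∶ s ⇓[ t ] s′ → (ifnz e then p else q) ∶ s ⇓[ 1 + cost e + t ] s′
  if-zero : ∀ {e p q s s′ t} → eval e s ≡ 0 →
    q ∶ s ⇓[ t ] s′ → (ifnz e then p else q) ∶ s ⇓[ 1 + cost e + t ] s′
  while-nonzero : ∀ {e p s s′ s″ t t′} → eval e s ≢ 0 →
    p ∶ s ⇓[ t ] s′ → (whilenz e loop p) ∶ s′ ⇓[ t′ ] s″ →
    (whilenz e loop p) ∶ s ⇓[ 1 + cost e + t + t′ ] s″
  while-zero : ∀ {e p s} → eval e s ≡ 0 →
    (whilenz e loop p) ∶ s ⇓[ 1 + cost e ] s

infix 3 _∶_⇓[_]_

contents : List ℕ → ℕ → ℕ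
contents []      _       = 0
contents (x ∷ w) zero    = x
contents (x ∷ w) (suc i) = contents w i

-- The input fills the first memory cells and its length is in register 0;
-- everything else is 0.
input : List ℕ → State
input w = ⟨ (λ _ → 0) [ 0 ↦ length w ] , contents w ⟩

output : State → ℕ
output s = registers s 0

{-# OPTIONS --safe #-}
module Submission where

-- An induced matching of a disjoint union splits into matchings of the two
-- sides.  In a join a crossing edge conflicts with every other edge, and edges
-- on different sides conflict, so the maximum there is max(1, k, l).  Two
-- separated edges in the complement of a tree would give a 4-cycle in the tree,
-- so the maximum is at most 1, and it is 1 exactly when the tree is not complete.
-- In a tree, leaves are pruned one after another, each towards its unique
-- remaining neighbour, its parent.  A vertex gets label 2 if some child has
-- label 1, label 1 if no child has label 1 but some child has label 0, and label 0
-- otherwise.  Joining each vertex of label 1 to a child of label 0 gives an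
-- induced matching; it is maximum because every edge meets x or the parent of x
-- for some x of label 1, and edges sharing such an x are not separated.
-- The program stores with each vertex its current degree and the sum of its
-- remaining neighbours, so the parent of a leaf is read off without searching.

open import Defs
open import Data.Bool using (if_then_else_)
open import Data.Nat using (ℕ; zero; suc; _+_; _*_; _∸_; _≤_; _<_; _⊔_; _≤?_; z≤n; s≤s)
import Data.Nat.Properties as ℕ
open import Data.Nat.ListAction using (sum)
open import Data.Nat.Tactic.RingSolver using (solve-∀)
open import Data.Fin using (Fin; zero; suc; toℕ; fromℕ<; combine)
open import Data.Fin.Patterns using (0F; 1F; 2F)
import Data.Fin.Properties as Fin
open import Data.List
  using (List; []; _∷_; _++_; [_]; length; map; concatMap; allFin; filter; lookup; tabulate)
import Data.List.Properties as List
open import Data.List.Membership.Propositional using (_∈_; _∉_)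
open import Data.List.Membership.Propositional.Properties
  using (∈-lookup; ∈-allFin; ∈-filter⁺; ∈-filter⁻; ∈-map⁻)
open import Data.List.Relation.Binary.Disjoint.Propositional using (Disjoint)
open import Data.List.Relation.Unary.Any using (here; there; index)
open import Data.List.Relation.Unary.Any.Properties using (lookup-index)
open import Data.List.Relation.Unary.All as All using (All; []; _∷_)
import Data.List.Relation.Unary.All.Properties as All
open import Data.List.Relation.Unary.AllPairs as AllPairs using (AllPairs; []; _∷_)
import Data.List.Relation.Unary.AllPairs.Properties as AllPairs
open import Data.List.Relation.Unary.Unique.Propositional using (Unique)
import Data.List.Relation.Unary.Unique.Propositional.Properties as Unique
open import Data.Maybe using (Maybe; just; nothing)
open import Data.Maybe.Properties using (just-injective; ≡-dec)
open import Data.Product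
  using (∃; ∃₂; ∃-syntax; Σ-syntax; _×_; _,_; proj₁; proj₂; uncurry)
open import Data.Sum as Sum using (_⊎_; inj₁; inj₂)
open import Data.Sum.Function.Propositional using (_⊎-↔_)
open import Data.Sum.Properties using (inj₁-injective; inj₂-injective)
open import Data.Sum.Relation.Binary.Pointwise using (inj₁; inj₂)
open import Function using (_∘_)
open import Function.Bundles using (Equivalence; Injection; Inverse; _↔_)
open import Function.Construct.Composition using (_↔-∘_)
open import Function.Construct.Identity using (↔-id)
open import Function.Properties.Inverse using (↔⇒↣)
open import Relation.Binary.Construct.Closure.ReflexiveTransitive using (ε; _◅_)
open import Relation.Binary.PropositionalEquality
  using (_≡_; _≢_; refl; sym; trans; cong; cong₂; subst; subst₂; module ≡-Reasoning)
open import Relation.Nullary using (¬_; Dec; yes; no; contradiction)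
open import Relation.Nullary.Decidable
  using (decidable-stable; dec-false; dec-true; from-yes; ¬?)

-- The labels certify optimality by a duality: a vertex of label 1 together with its parent, if it
-- has one, forms a clique; every edge meets one of these cliques, and two separated edges cannot
-- meet the same one. The time must be linear in `n`, not merely in the length of the input, so the
-- total length of the adjacency lists has to be bounded as well; the orientation towards parents
-- that pruning produces does this too. Pruning needs no queue of leaves. A cursor climbs from a
-- removed vertex to its parent for as long as it meets leaves, and otherwise a scanning position
-- moves on by one, so a tree with `m` vertices takes at most `2 * m` iterations. The machine only
-- adds and subtracts with truncation, which is why maxima, equality tests and the label update
-- appear as unusual formulas.

-- Lists without repetitions

lookup-injective : ∀ {A : Set} {xs : List A} → Unique xs →
                   ∀ {i j} → lookup xs i ≡ lookup xs j → i ≡ j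
lookup-injective (x∉ ∷ _)  {zero}  {zero}  _  = refl
lookup-injective (x∉ ∷ _)  {zero}  {suc j} eq = contradiction eq (All.lookup x∉ (∈-lookup j))
lookup-injective (x∉ ∷ _)  {suc i} {zero}  eq = contradiction (sym eq) (All.lookup x∉ (∈-lookup i))
lookup-injective (_ ∷ xs!) {suc i} {suc j} eq = cong suc (lookup-injective xs! eq)

unique-⊆⇒length≤ : ∀ {A : Set} {xs ys : List A} → Unique xs → All (_∈ ys) xs →
                   length xs ≤ length ys
unique-⊆⇒length≤ {xs = xs} {ys} xs! xs⊆ys = Fin.injective⇒≤ {f = place} place-injective
  where
  place : Fin (length xs) → Fin (length ys)
  place i = index (All.lookup xs⊆ys (∈-lookup i))

  place-injective : ∀ {i j} → place i ≡ place j → i ≡ j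
  place-injective {i} {j} eq = lookup-injective xs!
    (trans (lookup-index (All.lookup xs⊆ys (∈-lookup i)))
    (trans (cong (lookup ys) eq)
           (sym (lookup-index (All.lookup xs⊆ys (∈-lookup j))))))

unique⇒length≤ : ∀ {n} {xs : List (Fin n)} → Unique xs → length xs ≤ n
unique⇒length≤ {n} {xs} xs! = subst (length xs ≤_) (List.length-tabulate (λ (i : Fin n) → i))
  (unique-⊆⇒length≤ xs! (All.tabulate λ {x} _ → ∈-allFin x))

unique⇒allPairs : ∀ {A : Set} {P : A → Set} {R : A → A → Set} →
                  (∀ {x y} → P x → P y → x ≢ y → R x y) →
                  ∀ {xs} → All P xs → Unique xs → AllPairs R xs
unique⇒allPairs f []         []          = []
unique⇒allPairs f (px ∷ pxs) (x∉ ∷ xs!) =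
  All.zipWith (λ (py , x≢y) → f px py x≢y) (pxs , x∉) ∷ unique⇒allPairs f pxs xs!

∃-other : ∀ {A : Set} → (∀ (x y : A) → Dec (x ≡ y)) →
          ∀ {xs : List A} {y} → Unique xs → length xs ≢ 1 → y ∈ xs →
          ∃ λ z → z ∈ xs × z ≢ y
∃-other _≟_ {_ ∷ []}    _          ≢1 _ = contradiction refl ≢1
∃-other _≟_ {a ∷ b ∷ _} {y} ((a≢b ∷ _) ∷ _) _  _ with a ≟ y
... | yes refl = b , there (here refl) , a≢b ∘ sym
... | no a≢y   = a , here refl , a≢y

-- Labelled rooted forests

module _ {m} (H : Graph (Fin m)) where

  -- The newest vertex of a path has index 0.
  record Path (R : Fin m → List (Fin m)) (k : ℕ) : Set where
    field
      vertex   : ℕ → Fin m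
      distinct : ∀ {i j} → i ≤ k → j ≤ k → vertex i ≡ vertex j → i ≡ j
      back     : ∀ {i} → i < k → vertex (suc i) ∈ R (vertex i)

  module _ (acyclic : ¬ Cycle H) (R : Fin m → List (Fin m))
           (sound   : ∀ {v w} → w ∈ R v → Adj H v w)
           (reverse : ∀ {v w} → w ∈ R v → v ∈ R w)
           (R!      : ∀ v → Unique (R v))
           (no-leaf : ∀ v → length (R v) ≢ 1) where

    -- The newest vertex has a neighbour other than its predecessor. Either that neighbour is new
    -- and lengthens the path, or it lies on the path and closes a cycle. `d` counts down the
    -- extensions: at 0 the path would have more vertices than the graph.
    path⇒⊥ : ∀ d {k} → m ≤ k + d → ¬ Path R (suc k)
    path⇒⊥ zero {k} m≤ p = ℕ.<⇒≱ (ℕ.n<1+n k) (ℕ.≤-trans (ℕ.n≤1+n _) (ℕ.≤-trans k≤m (subst (m ≤_) (ℕ.+-identityʳ k) m≤)))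
      where
      open Path p
      k≤m : 2 + k ≤ m
      k≤m = Fin.injective⇒≤ {f = vertex ∘ toℕ {2 + k}} λ {i} {j} eq →
        Fin.toℕ-injective (distinct (Fin.toℕ≤pred[n] i) (Fin.toℕ≤pred[n] j) eq)
    path⇒⊥ (suc d) {k} m≤ p
      with z , z∈ , z≢ ← ∃-other Fin._≟_ (R! _) (no-leaf _) (Path.back p (s≤s z≤n))
      with Fin.any? (λ (j : Fin (2 + k)) → z Fin.≟ Path.vertex p (toℕ j))
    ... | no new = path⇒⊥ d (subst (m ≤_) (ℕ.+-suc k d) m≤) record
        { vertex = λ { zero → z ; (suc i) → vertex i }
        ; distinct = λ { {zero} {zero} _ _ _ → refl
                       ; {zero} {suc j} _ (s≤s j≤) eq → contradiction eq (fresh j≤)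
                       ; {suc i} {zero} (s≤s i≤) _ eq → contradiction (sym eq) (fresh i≤)
                       ; {suc i} {suc j} (s≤s i≤) (s≤s j≤) eq → cong suc (distinct i≤ j≤ eq) }
        ; back = λ { {zero} _ → reverse z∈ ; {suc i} (s≤s i<) → back i< }
        }
      where
      open Path p
      fresh : ∀ {j} → j ≤ suc k → z ≢ vertex j
      fresh j≤ eq = new (fromℕ< (s≤s j≤) , trans eq (cong vertex (sym (Fin.toℕ-fromℕ< (s≤s j≤)))))
    ... | yes (j , z≡) with toℕ j | Fin.toℕ≤pred[n] j
    -- Index 0 would be a loop and index 1 is the excluded predecessor; any later index
    -- `suc (suc e)` closes a cycle on the `3 + e` newest vertices.
    ...   | 0           | _  = irrefl H (subst (Adj H _) z≡ (sound z∈))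
    ...   | 1           | _  = z≢ z≡
    ...   | suc (suc e) | j≤ = acyclic record
        { extra    = e
        ; vertex   = vertex ∘ toℕ
        ; distinct = λ {i} {i′} eq → Fin.toℕ-injective
            (distinct (ℕ.≤-trans (Fin.toℕ≤pred[n] i) j≤) (ℕ.≤-trans (Fin.toℕ≤pred[n] i′) j≤) eq)
        ; step     = λ i → subst (λ a → Adj H (vertex a) (vertex (suc (toℕ i)))) (sym (Fin.toℕ-inject₁ i))
            (sound (back (ℕ.≤-trans (Fin.toℕ<n i) j≤)))
        ; close    = subst (λ a → Adj H (vertex a) (vertex 0)) (sym (Fin.toℕ-fromℕ (2 + e)))
            (symm H (subst (Adj H _) z≡ (sound z∈)))
        }
      where open Path p

    -- An edge is already a path with two vertices, so `path⇒⊥` applies. At the end of pruning this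
    -- shows that every edge has been oriented once no vertex of degree 1 remains.
    no-leaf⇒no-edge : ∀ {v w} → ¬ (w ∈ R v)
    no-leaf⇒no-edge {v} {w} w∈ = path⇒⊥ m (ℕ.≤-refl) record
      { vertex   = λ { zero → v ; (suc _) → w }
      ; distinct = λ { {zero} {zero} _ _ _ → refl
                     ; {zero} {suc zero} _ _ v≡w → contradiction v≡w v≢w
                     ; {suc zero} {zero} _ _ w≡v → contradiction (sym w≡v) v≢w
                     ; {suc zero} {suc zero} _ _ _ → refl
                     ; {suc (suc _)} (s≤s ()) ; {_} {suc (suc _)} _ (s≤s ()) }
      ; back     = λ { {zero} _ → w∈ ; {suc _} (s≤s ()) }
      }
      where
      v≢w : v ≢ w
      v≢w refl = irrefl H (sound w∈)

  -- The outcome of pruning leaves, with par v the neighbour v had when it was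
  -- removed.  Labels: 0 if all children have label 2, 1 if some child has
  -- label 0 and none has label 1, and 2 if some child has label 1.
  record Pruning (par : Fin m → Maybe (Fin m)) (label : Fin m → ℕ) : Set where
    field
      parent-adj : ∀ {v w} → par v ≡ just w → Adj H v w
      label≤2    : ∀ v → label v ≤ 2
      dominates  : ∀ {c v} → par c ≡ just v → label c < 2 → label c < label v
      supported  : ∀ {v k} → label v ≡ suc k → ∃ λ c → par c ≡ just v × label c ≡ k
      oriented   : ∀ {v w} → Adj H v w → par v ≡ just w ⊎ par w ≡ just v

  heads : (Fin m → ℕ) → List (Fin m)
  heads label = filter (λ v → label v ℕ.≟ 1) (allFin m)

  module _ {par label} (P : Pruning par label) where
    open Pruning P

    private
      -- Total, so that it can be mapped over `heads`; at label 0 the vertex itself is a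
      -- placeholder. The label is a separate argument because `supported` expects it in the form
      -- `suc k`.
      partner′ : ∀ v k → label v ≡ k → Fin m
      partner′ v zero    _  = v
      partner′ v (suc k) eq = proj₁ (supported eq)

      partner : Fin m → Fin m
      partner v = partner′ v _ refl

      Head : Fin m → Set
      Head v = label v ≡ 1

      partner-spec : ∀ {v} → Head v → par (partner v) ≡ just v × label (partner v) ≡ 0
      partner-spec {v} = go _ refl
        where
        go : ∀ k (eq : label v ≡ k) → k ≡ 1 → par (partner′ v k eq) ≡ just v × label (partner′ v k eq) ≡ 0
        go .1 eq refl = proj₂ (supported eq)

      heads-spec : All Head (heads label)
      heads-spec = All.tabulate λ v∈ → proj₂ (∈-filter⁻ (λ v → label v ℕ.≟ 1) {xs = allFin m} v∈)

      clash : ∀ {a b} → a ≡ 1 → b ≡ 0 → a ≢ b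
      clash refl refl ()

      ¬child : ∀ {c v k l} → par c ≡ just v → label c ≡ k → label v ≡ l → k < 2 → l ≤ k → ∀ {A : Set} → A
      ¬child p refl refl k<2 l≤k = contradiction (dominates p k<2) (ℕ.≤⇒≯ l≤k)

      -- Labels increase strictly from a child of label below 2 to its parent, which excludes an
      -- edge between two heads and a head whose parent is a partner. The other cases contradict
      -- uniqueness of parents: a partner below a foreign head would make the two heads equal, and a
      -- partner below a partner would make a vertex of label 1 equal to one of label 0.
      separated : ∀ {v w} → Head v → Head w → v ≢ w → Separated H (v , partner v) (w , partner w)
      separated {v} {w} hv hw v≢w
        with pv , lv ← partner-spec hv | pw , lw ← partner-spec hw =
          (v≢w , λ a → ¬HH (oriented a)) ,
          (clash hv lw ∘ cong label , λ a → ¬HC hv pw lw v≢w (oriented a)) ,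
          (clash hw lv ∘ cong label ∘ sym , λ a → ¬HC hw pv lv (v≢w ∘ sym) (oriented (symm H a))) ,
          ((λ eq → v≢w (just-injective (trans (sym pv) (trans (cong par eq) pw)))) ,
           λ a → ¬CC (oriented a))
        where
        ¬HH : ¬ (par v ≡ just w ⊎ par w ≡ just v)
        ¬HH (inj₁ p) = ¬child p hv hw (s≤s (s≤s z≤n)) ℕ.≤-refl
        ¬HH (inj₂ p) = ¬child p hw hv (s≤s (s≤s z≤n)) ℕ.≤-refl
        ¬HC : ∀ {a b c} → Head a → par c ≡ just b → label c ≡ 0 → a ≢ b → ¬ (par a ≡ just c ⊎ par c ≡ just a)
        ¬HC ha pc lc a≢b (inj₁ p) = ¬child p ha lc (s≤s (s≤s z≤n)) z≤n
        ¬HC ha pc lc a≢b (inj₂ p) = a≢b (just-injective (trans (sym p) pc))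
        ¬CC : ¬ (par (partner v) ≡ just (partner w) ⊎ par (partner w) ≡ just (partner v))
        ¬CC (inj₁ p) = clash hv (proj₂ (partner-spec hw))
          (cong label (just-injective (trans (sym (proj₁ (partner-spec hv))) p)))
        ¬CC (inj₂ p) = clash hw (proj₂ (partner-spec hv))
          (cong label (just-injective (trans (sym (proj₁ (partner-spec hw))) p)))

      Near : Fin m → Fin m → Set
      Near x y = y ≡ x ⊎ par x ≡ just y

      _On_ : Fin m → Fin m × Fin m → Set
      y On (a , b) = y ≡ a ⊎ y ≡ b

      -- If `v` has label 1, it is the head itself; if it has label 2, some child of it has label 1.
      -- If it has label 0, `dominates` leaves only label 2 for `c`, which then has a child of label
      -- 1.
      hitting : ∀ {c v} → par c ≡ just v → ∃ λ x → Head x × ∃ λ y → Near x y × (y ≡ c ⊎ y ≡ v)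
      hitting {c} {v} p with label v in lv | label≤2 v
      ... | 1 | _ = v , lv , v , inj₁ refl , inj₂ refl
      ... | 2 | _ with x , px , lx ← supported lv = x , lx , v , inj₂ px , inj₂ refl
      ... | suc (suc (suc _)) | s≤s (s≤s ())
      hitting {c} {v} p | 0 | _ with label c in lc | label≤2 c
      ... | 0 | _ = ¬child p lc lv (s≤s z≤n) z≤n
      ... | 1 | _ = ¬child p lc lv (s≤s (s≤s z≤n)) z≤n
      ... | 2 | _ with x , px , lx ← supported lc = x , lx , c , inj₂ px , inj₁ refl
      ... | suc (suc (suc _)) | s≤s (s≤s ())

      Hits : Fin m × Fin m → Fin m → Set
      Hits e x = Head x × ∃ λ y → Near x y × y On e

      hits : ∀ {e} → uncurry (Adj H) e → ∃ (Hits e)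
      hits a with oriented a
      ... | inj₁ p = hitting p
      ... | inj₂ p with x , hx , y , near , at ← hitting p = x , hx , y , near , Sum.swap at

      near-near : ∀ {x y z} → Near x y → Near x z → y ≡ z ⊎ Adj H y z
      near-near (inj₁ refl) (inj₁ refl) = inj₁ refl
      near-near (inj₁ refl) (inj₂ p)    = inj₂ (parent-adj p)
      near-near (inj₂ p)    (inj₁ refl) = inj₂ (symm H (parent-adj p))
      near-near (inj₂ p)    (inj₂ q)    = inj₁ (just-injective (trans (sym p) q))

      apart : ∀ {e f y z} → Separated H e f → y On e → z On f → ¬ (y ≡ z ⊎ Adj H y z)
      apart ((≢ , ¬a) , _) (inj₁ refl) (inj₁ refl) = Sum.[ ≢ , ¬a ]
      apart (_ , (≢ , ¬a) , _) (inj₁ refl) (inj₂ refl) = Sum.[ ≢ , ¬a ]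
      apart (_ , _ , (≢ , ¬a) , _) (inj₂ refl) (inj₁ refl) = Sum.[ ≢ , ¬a ]
      apart (_ , _ , _ , (≢ , ¬a)) (inj₂ refl) (inj₂ refl) = Sum.[ ≢ , ¬a ]

      hitters : ∀ {M} → All (uncurry (Adj H)) M → List (Fin m)
      hitters = All.reduce (λ a → proj₁ (hits a))

      hitters-length : ∀ {M} (as : All (uncurry (Adj H)) M) → length (hitters as) ≡ length M
      hitters-length []       = refl
      hitters-length (_ ∷ as) = cong suc (hitters-length as)

      hitters⊆heads : ∀ {M} (as : All (uncurry (Adj H)) M) → All (_∈ heads label) (hitters as)
      hitters⊆heads []       = []
      hitters⊆heads (a ∷ as) =
        ∈-filter⁺ (λ v → label v ℕ.≟ 1) (∈-allFin _) (proj₁ (proj₂ (hits a))) ∷ hitters⊆heads as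

      -- If one head hit two edges, they would have ends among the head and its parent, hence equal
      -- or adjacent ends, which separation forbids.
      hitters-new : ∀ {e M x} → Hits e x → All (Separated H e) M →
                   (as : All (uncurry (Adj H)) M) → All (x ≢_) (hitters as)
      hitters-new h [] [] = []
      hitters-new h@(_ , y , near , at) (s ∷ ss) (a ∷ as) =
        (λ { refl → let (_ , _ , near′ , at′) = proj₂ (hits a) in apart s at at′ (near-near near near′) })
        ∷ hitters-new h ss as

      hitters! : ∀ {M} (as : All (uncurry (Adj H)) M) → AllPairs (Separated H) M → Unique (hitters as)
      hitters! []       []       = []
      hitters! (a ∷ as) (s ∷ ss) = hitters-new (proj₂ (hits a)) s as ∷ hitters! as ss

    heads-max : IsMaxInducedMatchingSize H (length (heads label))
    heads-max =
      (map (λ v → v , partner v) (heads label) ,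
       (All.map⁺ (All.map (λ h → symm H (parent-adj (proj₁ (partner-spec h)))) heads-spec) ,
        AllPairs.map⁺ (unique⇒allPairs separated heads-spec
          (Unique.filter⁺ (λ v → label v ℕ.≟ 1) (Unique.allFin⁺ m)))) ,
       List.length-map _ (heads label)) ,
      λ M (as , ss) → subst (_≤ length (heads label)) (hitters-length as)
        (unique-⊆⇒length≤ (hitters! as ss) (hitters⊆heads as))

-- The entry w of the list of v is charged to v if w is the parent of v, and to w
-- otherwise, so each vertex is charged at most three times, the third charge being
-- for the length of its list.
module _ {m} {H : Graph (Fin m)} (A : AdjacencyLists H)
         (par : Fin m → Maybe (Fin m))
         (oriented : ∀ {v w} → Adj H v w → par v ≡ just w ⊎ par w ≡ just v) where
  open AdjacencyLists A

  private
    entry : Fin m → Fin m → Fin (3 * m)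
    entry v w with ≡-dec Fin._≟_ (par v) (just w)
    ... | yes _ = combine {3} 1F v
    ... | no _  = combine {3} 2F w

    entries : Fin m → List (Fin (3 * m))
    entries v = combine {3} 0F v ∷ map (entry v) (neighbours v)

    -- Recovers the list from which a charge comes: tags 0 and 1 carry its vertex, tag 2 carries a
    -- child of that vertex. As a child has only one parent, charges from different lists are
    -- disjoint.
    Owner : Fin (3 * m) → Fin m → Set
    Owner z v = (z ≡ combine {3} 0F v ⊎ z ≡ combine {3} 1F v) ⊎
                ∃ λ w → par w ≡ just v × z ≡ combine {3} 2F w

    tag : ∀ (i k : Fin 3) {v w : Fin m} → combine i v ≡ combine k w → i ≡ k × v ≡ w
    tag i k {v} {w} = Fin.combine-injective i v k w

    owner! : ∀ {z v w} → Owner z v → Owner z w → v ≡ w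
    owner! (inj₁ (inj₁ p)) (inj₁ (inj₁ q)) = proj₂ (tag 0F 0F (trans (sym p) q))
    owner! (inj₁ (inj₁ p)) (inj₁ (inj₂ q)) with () ← proj₁ (tag 0F 1F (trans (sym p) q))
    owner! (inj₁ (inj₁ p)) (inj₂ (_ , _ , q)) with () ← proj₁ (tag 0F 2F (trans (sym p) q))
    owner! (inj₁ (inj₂ p)) (inj₁ (inj₁ q)) with () ← proj₁ (tag 1F 0F (trans (sym p) q))
    owner! (inj₁ (inj₂ p)) (inj₁ (inj₂ q)) = proj₂ (tag 1F 1F (trans (sym p) q))
    owner! (inj₁ (inj₂ p)) (inj₂ (_ , _ , q)) with () ← proj₁ (tag 1F 2F (trans (sym p) q))
    owner! (inj₂ (_ , _ , p)) (inj₁ (inj₁ q)) with () ← proj₁ (tag 2F 0F (trans (sym p) q))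
    owner! (inj₂ (_ , _ , p)) (inj₁ (inj₂ q)) with () ← proj₁ (tag 2F 1F (trans (sym p) q))
    owner! (inj₂ (_ , pv , p)) (inj₂ (_ , pw , q)) = just-injective
      (trans (sym pv) (trans (cong par (proj₂ (tag 2F 2F (trans (sym p) q)))) pw))

    entry-owner : ∀ {v w} → Adj H v w → Owner (entry v w) v
    entry-owner {v} {w} a with ≡-dec Fin._≟_ (par v) (just w)
    ... | yes _ = inj₁ (inj₂ refl)
    ... | no ¬p with oriented a
    ...   | inj₁ p = contradiction p ¬p
    ...   | inj₂ p = inj₂ (w , p , refl)

    entries-owner : ∀ v {z} → z ∈ entries v → Owner z v
    entries-owner v (here refl) = inj₁ (inj₁ refl)
    entries-owner v (there z∈) with w , w∈ , refl ← ∈-map⁻ (entry v) z∈ =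
      entry-owner (Equivalence.to (complete v w) w∈)

    entry-injective : ∀ v {w x} → entry v w ≡ entry v x → w ≡ x
    entry-injective v {w} {x} eq
      with ≡-dec Fin._≟_ (par v) (just w) | ≡-dec Fin._≟_ (par v) (just x)
    ... | yes p | yes q = just-injective (trans (sym p) q)
    ... | yes _ | no _ with () ← proj₁ (tag 1F 2F eq)
    ... | no _ | yes _ with () ← proj₁ (tag 2F 1F eq)
    ... | no _ | no _ = proj₂ (tag 2F 2F eq)

    entry≢ : ∀ v w → combine {3} 0F v ≢ entry v w
    entry≢ v w eq with ≡-dec Fin._≟_ (par v) (just w)
    ... | yes _ with () ← proj₁ (tag 0F 1F eq)
    ... | no _ with () ← proj₁ (tag 0F 2F eq)

    entries! : ∀ v → Unique (entries v)
    entries! v = All.map⁺ (All.tabulate λ {w} _ → entry≢ v w) ∷ Unique.map⁺ (entry-injective v) (unique v)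

    all-entries! : Unique (concatMap entries (allFin m))
    all-entries! = Unique.concat⁺
      (All.map⁺ (All.tabulate λ {v} _ → entries! v))
      (AllPairs.map⁺ (AllPairs.map disjoint (Unique.allFin⁺ m)))
      where
      disjoint : ∀ {v w} → v ≢ w → Disjoint (entries v) (entries w)
      disjoint v≢w (z∈v , z∈w) = v≢w (owner! (entries-owner _ z∈v) (entries-owner _ z∈w))

  length-word≤ : length word ≤ 3 * m
  length-word≤ = subst (_≤ 3 * m) (go (allFin m)) (unique⇒length≤ all-entries!)
    where
    go : ∀ vs → length (concatMap entries vs) ≡
                length (concatMap (λ v → length (neighbours v) ∷ map toℕ (neighbours v)) vs)
    go []       = refl
    go (v ∷ vs) = cong suc (trans (List.length-++ (map (entry v) (neighbours v)))
      (trans (cong₂ _+_ (trans (List.length-map (entry v) (neighbours v)) (sym (List.length-map toℕ (neighbours v)))) (go vs))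
             (sym (List.length-++ (map toℕ (neighbours v))))))

-- Induced matchings under graph operations

lift : ∀ {V W : Set} → (V → W) → V × V → W × W
lift f (x , y) = f x , f y

module _ {V W : Set} {G : Graph V} {H : Graph W} (f : V → W)
         (injective : ∀ {x y} → f x ≡ f y → x ≡ y)
         (to : ∀ {x y} → Adj G x y → Adj H (f x) (f y))
         (from : ∀ {x y} → Adj H (f x) (f y) → Adj G x y) where

  separated⁺ : ∀ {e e′} → Separated G e e′ → Separated H (lift f e) (lift f e′)
  separated⁺ ((n₁ , a₁) , (n₂ , a₂) , (n₃ , a₃) , (n₄ , a₄)) =
    (n₁ ∘ injective , a₁ ∘ from) , (n₂ ∘ injective , a₂ ∘ from) ,
    (n₃ ∘ injective , a₃ ∘ from) , (n₄ ∘ injective , a₄ ∘ from)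

  separated⁻ : ∀ {e e′} → Separated H (lift f e) (lift f e′) → Separated G e e′
  separated⁻ ((n₁ , a₁) , (n₂ , a₂) , (n₃ , a₃) , (n₄ , a₄)) =
    (n₁ ∘ cong f , a₁ ∘ to) , (n₂ ∘ cong f , a₂ ∘ to) ,
    (n₃ ∘ cong f , a₃ ∘ to) , (n₄ ∘ cong f , a₄ ∘ to)

  matching⁺ : ∀ {M} → IsInducedMatching G M → IsInducedMatching H (map (lift f) M)
  matching⁺ (as , ss) = All.map⁺ (All.map to as) , AllPairs.map⁺ (AllPairs.map separated⁺ ss)

  matching⁻ : ∀ {M} → IsInducedMatching H (map (lift f) M) → IsInducedMatching G M
  matching⁻ (as , ss) = All.map from (All.map⁻ as) , AllPairs.map separated⁻ (AllPairs.map⁻ ss)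

≅-isMax : ∀ {V W} {G : Graph V} {H : Graph W} {k} → G ≅ H →
          IsMaxInducedMatchingSize G k → IsMaxInducedMatchingSize H k
≅-isMax {G = G} {H} iso ((M , ok , refl) , max) =
  (map (lift to) M , matching⁺ {G = G} {H} to injective (fwd _ _) (bwd _ _) ok , List.length-map (lift to) M) ,
  λ N okN → subst (_≤ length M) (List.length-map (lift from) N)
    (max _ (matching⁺ {G = H} {G} from (λ {x} {y} eq → trans (sym (to-from x)) (trans (cong to eq) (to-from y)))
      (λ {x} {y} a → bwd _ _ (subst₂ (Adj H) (sym (to-from x)) (sym (to-from y)) a))
      (λ {x} {y} a → subst₂ (Adj H) (to-from x) (to-from y) (fwd _ _ a)) okN))
  where
  open _≅_ iso
  open Inverse bijection using (to; from)
  to-from = Inverse.strictlyInverseˡ bijection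
  from-to = Inverse.strictlyInverseʳ bijection
  injective : ∀ {x y} → to x ≡ to y → x ≡ y
  injective {x} {y} eq = trans (sym (from-to x)) (trans (cong from eq) (from-to y))
  fwd = λ x y → Equivalence.to (preserves x y)
  bwd = λ x y → Equivalence.from (preserves x y)

module _ {V W : Set} {G : Graph V} {H : Graph W} where

  private
    -- The interleaving is kept as data so that `All` and `AllPairs` statements about the whole list
    -- can be divided by recursion on it.
    data Split : List ((V ⊎ W) × (V ⊎ W)) → List (V × V) → List (W × W) → Set where
      []   : Split [] [] []
      left : ∀ {e L M N} → Split L M N → Split (lift inj₁ e ∷ L) (e ∷ M) N
      right : ∀ {e L M N} → Split L M N → Split (lift inj₂ e ∷ L) M (e ∷ N)

    split : ∀ {L} → All (uncurry (Adj (G ⊕ H))) L → ∃₂ (Split L)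
    split []                             = [] , [] , []
    split (_∷_ {inj₁ _ , inj₁ _} _ as) with _ , _ , s ← split as = _ , _ , left s
    split (_∷_ {inj₂ _ , inj₂ _} _ as) with _ , _ , s ← split as = _ , _ , right s

    split-length : ∀ {L M N} → Split L M N → length L ≡ length M + length N
    split-length []        = refl
    split-length (left s)  = cong suc (split-length s)
    split-length {M = M} (right s) = trans (cong suc (split-length s)) (sym (ℕ.+-suc (length M) _))

    split-All : ∀ {P : _ → Set} {L M N} → Split L M N → All P L → All (P ∘ lift inj₁) M × All (P ∘ lift inj₂) N
    split-All []        []       = [] , []
    split-All (left s)  (p ∷ ps) with qs , rs ← split-All s ps = p ∷ qs , rs
    split-All (right s) (p ∷ ps) with qs , rs ← split-All s ps = qs , p ∷ rs

    split-AllPairs : ∀ {R : _ → _ → Set} {L M N} → Split L M N → AllPairs R L →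
                     AllPairs (λ x y → R (lift inj₁ x) (lift inj₁ y)) M ×
                     AllPairs (λ x y → R (lift inj₂ x) (lift inj₂ y)) N
    split-AllPairs []        []       = [] , []
    split-AllPairs (left s)  (p ∷ ps) with qs , rs ← split-AllPairs s ps = proj₁ (split-All s p) ∷ qs , rs
    split-AllPairs (right s) (p ∷ ps) with qs , rs ← split-AllPairs s ps = qs , proj₂ (split-All s p) ∷ rs

    unl : ∀ {x y} → Adj (G ⊕ H) (inj₁ x) (inj₁ y) → Adj G x y
    unl (inj₁ a) = a

    unr : ∀ {x y} → Adj (G ⊕ H) (inj₂ x) (inj₂ y) → Adj H x y
    unr (inj₂ a) = a

  ⊕-isMax : ∀ {k l} → IsMaxInducedMatchingSize G k → IsMaxInducedMatchingSize H l →
            IsMaxInducedMatchingSize (G ⊕ H) (k + l)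
  ⊕-isMax ((M , okM , refl) , maxM) ((N , okN , refl) , maxN) =
    (map (lift inj₁) M ++ map (lift inj₂) N ,
     (All.++⁺ (proj₁ okM⁺) (proj₁ okN⁺) ,
      AllPairs.++⁺ (proj₂ okM⁺) (proj₂ okN⁺)
        (All.map⁺ (All.tabulate λ _ → All.map⁺ (All.tabulate λ _ →
          ((λ ()) , λ ()) , ((λ ()) , λ ()) , ((λ ()) , λ ()) , ((λ ()) , λ ()))))) ,
     trans (List.length-++ (map (lift inj₁) M)) (cong₂ _+_ (List.length-map (lift inj₁) M) (List.length-map (lift inj₂) N))) ,
    upper
    where
    okM⁺ = matching⁺ {G = G} {G ⊕ H} inj₁ inj₁-injective inj₁ unl okM
    okN⁺ = matching⁺ {G = H} {G ⊕ H} inj₂ inj₂-injective inj₂ unr okN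
    upper : ∀ L → IsInducedMatching (G ⊕ H) L → length L ≤ length M + length N
    upper L (as , ss) with _ , _ , s ← split as = subst (_≤ length M + length N) (sym (split-length s))
      (ℕ.+-mono-≤
        (maxM _ (All.map unl (proj₁ (split-All s as)) ,
          AllPairs.map (separated⁻ {G = G} {G ⊕ H} inj₁ inj₁-injective inj₁ unl) (proj₁ (split-AllPairs s ss))))
        (maxN _ (All.map unr (proj₂ (split-All s as)) ,
          AllPairs.map (separated⁻ {G = H} {G ⊕ H} inj₂ inj₂-injective inj₂ unr) (proj₂ (split-AllPairs s ss)))))

  private
    unjl : ∀ {x y} → Adj (G ⊗ H) (inj₁ x) (inj₁ y) → Adj G x y
    unjl (left a) = a

    unjr : ∀ {x y} → Adj (G ⊗ H) (inj₂ x) (inj₂ y) → Adj H x y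
    unjr (right a) = a

    -- A vertex of `H` is adjacent to both ends of an edge inside `G`, so an edge separated from
    -- that one has no end in `H`. A matching that starts inside one side therefore stays there.
    all-left : ∀ {e M} → All (Separated (G ⊗ H) (lift inj₁ e)) M → ∃ λ N → M ≡ map (lift inj₁) N
    all-left {M = []} [] = [] , refl
    all-left {M = (inj₁ a , inj₁ b) ∷ _} (_ ∷ ss) with N , refl ← all-left ss = (a , b) ∷ N , refl
    all-left {M = (inj₁ _ , inj₂ _) ∷ _} ((_ , (_ , ¬a) , _) ∷ _) = contradiction cross ¬a
    all-left {M = (inj₂ _ , _) ∷ _} (((_ , ¬a) , _) ∷ _) = contradiction cross ¬a

    all-right : ∀ {e M} → All (Separated (G ⊗ H) (lift inj₂ e)) M → ∃ λ N → M ≡ map (lift inj₂) N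
    all-right {M = []} [] = [] , refl
    all-right {M = (inj₂ a , inj₂ b) ∷ _} (_ ∷ ss) with N , refl ← all-right ss = (a , b) ∷ N , refl
    all-right {M = (inj₂ _ , inj₁ _) ∷ _} ((_ , (_ , ¬a) , _) ∷ _) = contradiction cross′ ¬a
    all-right {M = (inj₁ _ , _) ∷ _} (((_ , ¬a) , _) ∷ _) = contradiction cross′ ¬a

    alone : ∀ {v w e} → ¬ Separated (G ⊗ H) (inj₁ v , inj₂ w) e
    alone {e = inj₁ _ , _} (_ , _ , (_ , ¬a) , _) = ¬a cross′
    alone {e = inj₂ _ , _} ((_ , ¬a) , _) = ¬a cross

    alone′ : ∀ {v w e} → ¬ Separated (G ⊗ H) (inj₂ w , inj₁ v) e
    alone′ {e = inj₁ _ , _} ((_ , ¬a) , _) = ¬a cross′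
    alone′ {e = inj₂ _ , _} (_ , _ , (_ , ¬a) , _) = ¬a cross

  -- The vertices `v` and `w` supply a crossing edge, so size 1 is reached even when neither side
  -- has an edge.
  ⊗-isMax : ∀ {k l} → V → W → IsMaxInducedMatchingSize G k → IsMaxInducedMatchingSize H l →
            IsMaxInducedMatchingSize (G ⊗ H) (1 ⊔ (k ⊔ l))
  ⊗-isMax v w ((M , okM , refl) , maxM) ((N , okN , refl) , maxN) = lower , upper
    where
    k = length M
    l = length N
    okM⁺ = matching⁺ {G = G} {G ⊗ H} inj₁ inj₁-injective left unjl okM
    okN⁺ = matching⁺ {G = H} {G ⊗ H} inj₂ inj₂-injective right unjr okN
    lower : ∃ λ L → IsInducedMatching (G ⊗ H) L × length L ≡ 1 ⊔ (k ⊔ l)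
    lower with ℕ.⊔-sel 1 (k ⊔ l) | ℕ.⊔-sel k l
    ... | inj₁ eq | _       = (inj₁ v , inj₂ w) ∷ [] , (cross ∷ [] , [] ∷ []) , sym eq
    ... | inj₂ eq | inj₁ eq′ = _ , okM⁺ , trans (List.length-map _ M) (sym (trans eq eq′))
    ... | inj₂ eq | inj₂ eq′ = _ , okN⁺ , trans (List.length-map _ N) (sym (trans eq eq′))
    upper : ∀ L → IsInducedMatching (G ⊗ H) L → length L ≤ 1 ⊔ (k ⊔ l)
    upper [] _ = z≤n
    upper ((inj₁ _ , inj₂ _) ∷ []) _ = ℕ.m≤m⊔n 1 (k ⊔ l)
    upper ((inj₁ _ , inj₂ _) ∷ _ ∷ _) (_ , (s ∷ _) ∷ _) = contradiction s alone
    upper ((inj₂ _ , inj₁ _) ∷ []) _ = ℕ.m≤m⊔n 1 (k ⊔ l)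
    upper ((inj₂ _ , inj₁ _) ∷ _ ∷ _) (_ , (s ∷ _) ∷ _) = contradiction s alone′
    upper ((inj₁ a , inj₁ b) ∷ _) ok@(_ , s ∷ _) with L , refl ← all-left s =
      ℕ.≤-trans (subst (λ j → suc j ≤ k) (sym (List.length-map _ L))
          (maxM ((a , b) ∷ L) (matching⁻ {G = G} {G ⊗ H} inj₁ inj₁-injective left unjl ok)))
        (ℕ.≤-trans (ℕ.m≤m⊔n k l) (ℕ.m≤n⊔m 1 (k ⊔ l)))
    upper ((inj₂ a , inj₂ b) ∷ _) ok@(_ , s ∷ _) with L , refl ← all-right s =
      ℕ.≤-trans (subst (λ j → suc j ≤ l) (sym (List.length-map _ L))
          (maxN ((a , b) ∷ L) (matching⁻ {G = H} {G ⊗ H} inj₂ inj₂-injective right unjr ok)))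
        (ℕ.≤-trans (ℕ.m≤n⊔m k l) (ℕ.m≤n⊔m 1 (k ⊔ l)))

-- Complements of trees

module _ {m} (H : Graph (Fin m)) (T : IsTree H) where
  open IsTree T

  private
    distinct₃ : ∀ {a b c : Fin m} → a ≢ b → a ≢ c → b ≢ c → 3 ≤ m
    distinct₃ {a} {b} {c} a≢b a≢c b≢c = unique⇒length≤ {xs = a ∷ b ∷ c ∷ []}
      ((a≢b ∷ a≢c ∷ []) ∷ (b≢c ∷ []) ∷ [] ∷ [])

    -- The second vertex on a path from `a` to `b` is a third one: it is adjacent to `a`, while
    -- neither `a` nor `b` is.
    non-edge⇒3≤m : ∀ {a b} → a ≢ b → ¬ Adj H a b → 3 ≤ m
    non-edge⇒3≤m {a} {b} a≢b ¬ab with connected a b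
    ... | ε = contradiction refl a≢b
    ... | _◅_ {j = x} ax _ = distinct₃ {a} {b} {x} a≢b
      (λ { refl → irrefl H ax }) (λ { refl → ¬ab ax })

    triangle : ∀ {a b c} → Adj H a b → Adj H b c → ¬ Adj H c a
    triangle {a} {b} {c} ab bc ca = acyclic record
      { extra = 0
      ; vertex = λ { zero → a ; (suc zero) → b ; (suc (suc zero)) → c }
      ; distinct = λ
        { {zero} {zero} _ → refl ; {suc zero} {suc zero} _ → refl ; {suc (suc zero)} {suc (suc zero)} _ → refl
        ; {zero} {suc zero} refl → contradiction ab (irrefl H)
        ; {suc zero} {zero} refl → contradiction ab (irrefl H)
        ; {zero} {suc (suc zero)} refl → contradiction ca (irrefl H)
        ; {suc (suc zero)} {zero} refl → contradiction ca (irrefl H)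
        ; {suc zero} {suc (suc zero)} refl → contradiction bc (irrefl H)
        ; {suc (suc zero)} {suc zero} refl → contradiction bc (irrefl H) }
      ; step = λ { zero → ab ; (suc zero) → bc }
      ; close = ca
      }

    square : ∀ {a b c d} → a ≢ c → b ≢ d → Adj H a b → Adj H b c → Adj H c d → ¬ Adj H d a
    square {a} {b} {c} {d} a≢c b≢d ab bc cd da = acyclic record
      { extra = 1
      ; vertex = λ { zero → a ; (suc zero) → b ; (suc (suc zero)) → c ; (suc (suc (suc zero))) → d }
      ; distinct = λ
        { {zero} {zero} _ → refl ; {suc zero} {suc zero} _ → refl
        ; {suc (suc zero)} {suc (suc zero)} _ → refl
        ; {suc (suc (suc zero))} {suc (suc (suc zero))} _ → refl
        ; {zero} {suc zero} refl → contradiction ab (irrefl H)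
        ; {suc zero} {zero} refl → contradiction ab (irrefl H)
        ; {zero} {suc (suc zero)} eq → contradiction eq a≢c
        ; {suc (suc zero)} {zero} eq → contradiction (sym eq) a≢c
        ; {zero} {suc (suc (suc zero))} refl → contradiction da (irrefl H)
        ; {suc (suc (suc zero))} {zero} refl → contradiction da (irrefl H)
        ; {suc zero} {suc (suc zero)} refl → contradiction bc (irrefl H)
        ; {suc (suc zero)} {suc zero} refl → contradiction bc (irrefl H)
        ; {suc zero} {suc (suc (suc zero))} eq → contradiction eq b≢d
        ; {suc (suc (suc zero))} {suc zero} eq → contradiction (sym eq) b≢d
        ; {suc (suc zero)} {suc (suc (suc zero))} refl → contradiction cd (irrefl H)
        ; {suc (suc (suc zero))} {suc (suc zero)} refl → contradiction cd (irrefl H) }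
      ; step = λ { zero → ab ; (suc zero) → bc ; (suc (suc zero)) → cd }
      ; close = da
      }

    co-apart⇒adj : ∀ {a b} → a ≢ b × ¬ Adj (∁ H) a b → Adj H a b
    co-apart⇒adj {a} {b} (a≢b , ¬co) = decidable-stable (adj? H a b) λ ¬ab → ¬co (a≢b , ¬ab)

    upper : ∀ M → IsInducedMatching (∁ H) M → length M ≤ 1 ∸ (3 ∸ m)
    upper [] _ = z≤n
    upper (_ ∷ []) ((a≢b , ¬ab) ∷ _ , _) =
      ℕ.≤-reflexive (sym (cong (1 ∸_) (ℕ.m≤n⇒m∸n≡0 (non-edge⇒3≤m a≢b ¬ab))))
    upper (_ ∷ _ ∷ _) ((a≢b , _) ∷ (c≢d , _) ∷ _ , ((ac , ad , bc , bd) ∷ _) ∷ _) =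
      contradiction (symm H (co-apart⇒adj ad))
        (square a≢b c≢d (co-apart⇒adj ac) (symm H (co-apart⇒adj bc)) (co-apart⇒adj bd))

  -- `1 ∸ (3 ∸ m)` is 1 for `m` at least 3 and 0 otherwise. With three vertices or more, some two of
  -- the vertices 0, 1, 2 are not adjacent in the tree, since a triangle is a cycle.
  cotree-isMax : IsMaxInducedMatchingSize (∁ H) (1 ∸ (3 ∸ m))
  cotree-isMax = lower m refl , upper
    where
    single : ∀ {a b} → a ≢ b → ¬ Adj H a b → ∃ λ M → IsInducedMatching (∁ H) M × length M ≡ 1
    single a≢b ¬ab = (_ , _) ∷ [] , ((a≢b , ¬ab) ∷ [] , [] ∷ []) , refl
    lower : ∀ n → n ≡ m → ∃ λ M → IsInducedMatching (∁ H) M × length M ≡ 1 ∸ (3 ∸ m)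
    lower 0 refl = [] , ([] , []) , refl
    lower 1 refl = [] , ([] , []) , refl
    lower 2 refl = [] , ([] , []) , refl
    lower (suc (suc (suc n))) refl rewrite ℕ.0∸n≡0 n
      with adj? H zero (suc zero) | adj? H (suc zero) (suc (suc zero)) | adj? H (suc (suc zero)) zero
    ... | no ¬a  | _      | _      = single (λ ()) ¬a
    ... | yes _  | no ¬b  | _      = single (λ ()) ¬b
    ... | yes _  | yes _  | no ¬c  = single (λ ()) ¬c
    ... | yes a  | yes b  | yes c  = contradiction c (triangle a b)

-- The number of vertices of a decomposition tree

size : DecompositionTree → ℕ
size (leaf _ {m} _ _) = m
size (node _ L R)     = size L + size R

vertex↔ : ∀ T → Fin (size T) ↔ Vertex T
vertex↔ (leaf _ _ _) = ↔-id _
vertex↔ (node _ L R) = (vertex↔ L ⊎-↔ vertex↔ R) ↔-∘ Fin.+↔⊎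

size≤ : ∀ {n} {G : Graph (Fin n)} {T} → T IsDecompositionOf G → size T ≤ n
size≤ {T = T} iso = Fin.injective⇒≤ {f = to ∘ to′} λ eq → inj′ (inj eq)
  where
  open Inverse (_≅_.bijection iso) using (to)
  open Inverse (vertex↔ T) using () renaming (to to to′)
  inj = Injection.injective (↔⇒↣ (_≅_.bijection iso))
  inj′ = Injection.injective (↔⇒↣ (vertex↔ T))

-- Allows the fixed costs of a leaf to be charged to its vertices, and makes 0 a valid initial
-- cursor for pruning.
1≤size : ∀ T → 1 ≤ size T
1≤size (leaf _ {zero} _ isTree) with () ← IsTree.nonempty isTree
1≤size (leaf _ {suc _} _ _) = s≤s z≤n
1≤size (node _ L R) = ℕ.≤-trans (1≤size L) (ℕ.m≤m+n _ _)

someVertex : ∀ T → Vertex T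
someVertex (leaf _ _ isTree) = IsTree.nonempty isTree
someVertex (node _ L _)      = inj₁ (someVertex L)

-- Leaf pruning

module _ {m : ℕ} where

  _≢?_ : ∀ (u v : Fin m) → Dec (u ≢ v)
  u ≢? v = ¬? (u Fin.≟ v)

  delete : Fin m → List (Fin m) → List (Fin m)
  delete u = filter (u ≢?_)

  delete-absent : ∀ {u xs} → u ∉ xs → delete u xs ≡ xs
  delete-absent {u} u∉ = List.filter-all (u ≢?_) (All.tabulate λ x∈ → λ { refl → u∉ x∈ })

  ∈-delete⁻ : ∀ {u v xs} → v ∈ delete u xs → v ∈ xs
  ∈-delete⁻ {u} v∈ = proj₁ (∈-filter⁻ (u ≢?_) v∈)

  -- `f` is arbitrary so that both stored numbers are covered: the constant 1 gives the degree,
  -- `toℕ` the sum of the neighbours.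
  sum-delete : ∀ (f : Fin m → ℕ) {u xs} → Unique xs → u ∈ xs →
               sum (map f xs) ≡ f u + sum (map f (delete u xs))
  sum-delete f {u} {x ∷ xs} (x∉ ∷ xs!) u∈ with u Fin.≟ x | u∈
  ... | yes refl | _         = cong (λ l → f x + sum (map f l)) (sym (delete-absent λ x∈ → All.lookup x∉ x∈ refl))
  ... | no u≢x   | here u≡x  = contradiction u≡x u≢x
  ... | no u≢x   | there u∈′ = begin
    f x + sum (map f xs)                          ≡⟨ cong (f x +_) (sum-delete f xs! u∈′) ⟩
    f x + (f u + sum (map f (delete u xs)))       ≡⟨ ℕ.+-assoc (f x) (f u) _ ⟨
    f x + f u + sum (map f (delete u xs))         ≡⟨ cong (_+ sum (map f (delete u xs))) (ℕ.+-comm (f x) (f u)) ⟩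
    f u + f x + sum (map f (delete u xs))         ≡⟨ ℕ.+-assoc (f u) (f x) _ ⟩
    f u + (f x + sum (map f (delete u xs)))       ∎
    where open ≡-Reasoning

  length-delete : ∀ {u xs} → Unique xs → u ∈ xs → length xs ≡ suc (length (delete u xs))
  length-delete {u} {xs} xs! u∈ = trans (as-sum xs) (trans (sum-delete (λ _ → 1) xs! u∈) (cong suc (sym (as-sum (delete u xs)))))
    where
    as-sum : ∀ ys → length ys ≡ sum (map (λ _ → 1) ys)
    as-sum []       = refl
    as-sum (_ ∷ ys) = cong suc (as-sum ys)

-- The label that a removed vertex with label x forces on its parent: 0 ↦ 1,
-- 1 ↦ 2, 2 ↦ 0.  The truncated formula saves a test in the program.
bump : ℕ → ℕ
bump x = 1 + x ∸ (x ∸ 1 + (x ∸ 1) + (x ∸ 1))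

bump-suc : ∀ {x} → x < 2 → bump x ≡ suc x
bump-suc (s≤s z≤n)       = refl
bump-suc (s≤s (s≤s z≤n)) = refl

bump≤2 : ∀ {x} → x ≤ 2 → bump x ≤ 2
bump≤2 z≤n             = s≤s z≤n
bump≤2 (s≤s z≤n)       = s≤s (s≤s z≤n)
bump≤2 (s≤s (s≤s z≤n)) = z≤n

bump-injective : ∀ {x k} → x ≤ 2 → bump x ≡ suc k → x ≡ k
bump-injective z≤n             refl = refl
bump-injective (s≤s z≤n)       refl = refl
bump-injective (s≤s (s≤s z≤n)) ()

-- This is how the program computes a maximum.
m+[n∸m]≡m⊔n : ∀ m n → m + (n ∸ m) ≡ m ⊔ n
m+[n∸m]≡m⊔n zero    n       = refl
m+[n∸m]≡m⊔n (suc m) zero    = cong suc (ℕ.+-identityʳ m)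
m+[n∸m]≡m⊔n (suc m) (suc n) = cong suc (m+[n∸m]≡m⊔n m n)

module _ {m} (H : Graph (Fin m)) where

  -- rem v lists the neighbours of v along edges that have not been removed,
  -- and total v, meaningful only while rem v is nonempty, is their sum.
  record Stage (deg total label : Fin m → ℕ) (k : ℕ) : Set where
    field
      par        : Fin m → Maybe (Fin m)
      rem        : Fin m → List (Fin m)
      live       : List (Fin m)
      rem!       : ∀ v → Unique (rem v)
      deg≡       : ∀ v → deg v ≡ length (rem v)
      total≡     : ∀ {v w} → w ∈ rem v → total v ≡ sum (map toℕ (rem v))
      sound      : ∀ {v w} → w ∈ rem v → Adj H v w
      reverse    : ∀ {v w} → w ∈ rem v → v ∈ rem w
      parent-adj : ∀ {v w} → par v ≡ just w → Adj H v w
      removed    : ∀ {v w} → par v ≡ just w → rem v ≡ []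
      oriented   : ∀ {v w} → Adj H v w → w ∈ rem v ⊎ (par v ≡ just w ⊎ par w ≡ just v)
      label≤2    : ∀ v → label v ≤ 2
      dominates  : ∀ {c v} → par c ≡ just v → label c < 2 → label c < label v
      supported  : ∀ {v k} → label v ≡ suc k → ∃ λ c → par c ≡ just v × label c ≡ k
      live!      : Unique live
      all-live   : ∀ {v} → par v ≡ nothing → v ∈ live
      live≡      : length live ≡ k

  initial : (A : AdjacencyLists H) → let open AdjacencyLists A in
            ∀ {deg total label} →
            (∀ v → deg v ≡ length (neighbours v)) →
            (∀ v → total v ≡ sum (map toℕ (neighbours v))) →
            (∀ v → label v ≡ 0) → Stage deg total label m
  initial A {label = label} deg≡ total≡ label≡ = record
    { par        = λ _ → nothing
    ; rem        = neighbours
    ; live       = allFin m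
    ; rem!       = unique
    ; deg≡       = deg≡
    ; total≡     = λ {v} _ → total≡ v
    ; sound      = λ {v} {w} → Equivalence.to (complete v w)
    ; reverse    = λ {v} {w} → Equivalence.from (complete w v) ∘ symm H ∘ Equivalence.to (complete v w)
    ; parent-adj = λ ()
    ; removed    = λ ()
    ; oriented   = λ {v} {w} → inj₁ ∘ Equivalence.from (complete v w)
    ; label≤2    = λ v → subst (_≤ 2) (sym (label≡ v)) z≤n
    ; dominates  = λ ()
    ; supported  = λ {v} eq → contradiction (trans (sym (label≡ v)) eq) λ ()
    ; live!      = Unique.allFin⁺ m
    ; all-live   = λ {v} _ → ∈-allFin v
    ; live≡      = List.length-tabulate (λ i → i)
    }
    where open AdjacencyLists A

  -- Stated pointwise, so that it can be verified for arrays that are views of the memory. The sum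
  -- stored at `u` stays as it was; `total≡` asks nothing of it once no neighbour of `u` remains.
  record Removal (deg total label deg′ total′ label′ : Fin m → ℕ) (u p : Fin m) : Set where
    field
      deg-u   : deg′ u ≡ 0
      deg-p   : deg′ p ≡ deg p ∸ 1
      deg-v   : ∀ {v} → v ≢ u → v ≢ p → deg′ v ≡ deg v
      total-p : total′ p ≡ total p ∸ toℕ u
      total-v : ∀ {v} → v ≢ p → total′ v ≡ total v
      label-p : label′ p ≡ label p + (bump (label u) ∸ label p)
      label-v : ∀ {v} → v ≢ p → label′ v ≡ label v

  record Removable (deg total label : Fin m → ℕ) (k : ℕ) (u : Fin m) : Set where
    field
      p       : Fin m
      {k′}    : ℕ
      k≡      : k ≡ suc k′
      total≡p : total u ≡ toℕ p
      u≢p     : u ≢ p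
      remove  : ∀ {deg′ total′ label′} → Removal deg total label deg′ total′ label′ u p →
                Stage deg′ total′ label′ k′

  removable : ∀ {deg total label k u} → Stage deg total label k → deg u ≡ 1 →
              Removable deg total label k u
  removable {deg} {total} {label} {k} {u} S deg≡1 with Stage.rem S u in rem-u | Stage.deg≡ S u
  ... | []        | eq = contradiction (trans (sym eq) deg≡1) λ ()
  ... | _ ∷ _ ∷ _ | eq = contradiction (trans (sym eq) deg≡1) λ ()
  ... | p ∷ []    | _  = record
    { p       = p
    ; k≡      = trans (sym live≡) (length-delete live! (all-live par-u))
    ; total≡p = trans (total≡ p∈) (trans (cong (sum ∘ map toℕ) rem-u) (ℕ.+-identityʳ (toℕ p)))
    ; u≢p     = u≢p
    ; remove  = remove
    }
    where
    open Stage S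
    p∈ : p ∈ rem u
    p∈ = subst (p ∈_) (sym rem-u) (here refl)

    u∈ : u ∈ rem p
    u∈ = reverse p∈

    u≢p : u ≢ p
    u≢p refl = irrefl H (sound p∈)

    nonempty⇒live : ∀ {v w} → w ∈ rem v → par v ≡ nothing
    nonempty⇒live {v} w∈ with par v in eq
    ... | nothing = refl
    ... | just _ with () ← subst (_ ∈_) (removed eq) w∈

    par-u : par u ≡ nothing
    par-u = nonempty⇒live p∈

    -- A vertex with a remaining edge has no parent yet. So labels are frozen at removal: an update
    -- changes only the label of `p`, whose list still contains `u`. This is what preserves the
    -- relations between old children and their parents.
    not-child : ∀ {c v w} → par c ≡ just v → w ∈ rem c → ∀ {A : Set} → A
    not-child par-c w∈ with () ← trans (sym par-c) (nonempty⇒live w∈)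

    ∈-rem-u : ∀ {v} → v ∈ rem u → v ≡ p
    ∈-rem-u v∈ with here eq ← subst (_ ∈_) rem-u v∈ = eq

    par′ : Fin m → Maybe (Fin m)
    par′ v with u Fin.≟ v
    ... | yes _ = just p
    ... | no _  = par v

    rem′ : Fin m → List (Fin m)
    rem′ v with u Fin.≟ v
    ... | yes _ = []
    ... | no _  = delete u (rem v)

    par′-u : par′ u ≡ just p
    par′-u with u Fin.≟ u
    ... | yes _ = refl
    ... | no u≢ = contradiction refl u≢

    par′-v : ∀ {v} → u ≢ v → par′ v ≡ par v
    par′-v {v} u≢v with u Fin.≟ v
    ... | yes u≡v = contradiction u≡v u≢v
    ... | no _    = refl

    par′⁻ : ∀ {c v} → par′ c ≡ just v → (c ≡ u × v ≡ p) ⊎ (u ≢ c × par c ≡ just v)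
    par′⁻ {c} eq with u Fin.≟ c
    ... | yes refl = inj₁ (refl , sym (just-injective eq))
    ... | no u≢c   = inj₂ (u≢c , eq)

    rem′-u : rem′ u ≡ []
    rem′-u with u Fin.≟ u
    ... | yes _ = refl
    ... | no u≢ = contradiction refl u≢

    rem′⊆ : ∀ {v w} → w ∈ rem′ v → w ∈ rem v
    rem′⊆ {v} w∈ with u Fin.≟ v
    ... | no _ = ∈-delete⁻ w∈

    rem′⁺ : ∀ {v w} → u ≢ v → u ≢ w → w ∈ rem v → w ∈ rem′ v
    rem′⁺ {v} u≢v u≢w w∈ with u Fin.≟ v
    ... | yes u≡v = contradiction u≡v u≢v
    ... | no _    = ∈-filter⁺ (u ≢?_) w∈ u≢w

    rem′⇒≢ : ∀ {v w} → w ∈ rem′ v → u ≢ v × u ≢ w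
    rem′⇒≢ {v} w∈ with u Fin.≟ v
    ... | no u≢v = u≢v , proj₂ (∈-filter⁻ (u ≢?_) {xs = rem v} w∈)

    rem′! : ∀ v → Unique (rem′ v)
    rem′! v with u Fin.≟ v
    ... | yes _ = []
    ... | no _  = Unique.filter⁺ (u ≢?_) (rem! v)

    rem′-p : rem′ p ≡ delete u (rem p)
    rem′-p with u Fin.≟ p
    ... | yes u≡p = contradiction u≡p u≢p
    ... | no _    = refl

    rem′-v : ∀ {v} → v ≢ u → v ≢ p → rem′ v ≡ rem v
    rem′-v {v} v≢u v≢p with u Fin.≟ v
    ... | yes u≡v = contradiction (sym u≡v) v≢u
    ... | no _    = delete-absent (v≢p ∘ ∈-rem-u ∘ reverse)

    remove : ∀ {deg′ total′ label′} → Removal deg total label deg′ total′ label′ u p →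
             Stage deg′ total′ label′ (length (delete u live))
    remove {deg′} {total′} {label′} R = record
      { par        = par′
      ; rem        = rem′
      ; live       = delete u live
      ; rem!       = rem′!
      ; deg≡       = deg′≡
      ; total≡     = total′≡
      ; sound      = sound ∘ rem′⊆
      ; reverse    = λ w∈ → let u≢v , u≢w = rem′⇒≢ w∈ in rem′⁺ u≢w u≢v (reverse (rem′⊆ w∈))
      ; parent-adj = λ eq → parent-adj′ (par′⁻ eq)
      ; removed    = removed′
      ; oriented   = oriented′
      ; label≤2    = label′≤2
      ; dominates  = λ eq → dominates′ (par′⁻ eq)
      ; supported  = supported′
      ; live!      = Unique.filter⁺ (u ≢?_) live!
      ; all-live   = all-live′
      ; live≡      = refl
      }
      where
      open Removal R
      parent-adj′ : ∀ {v w} → (v ≡ u × w ≡ p) ⊎ (u ≢ v × par v ≡ just w) → Adj H v w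
      parent-adj′ (inj₁ (refl , refl)) = sound p∈
      parent-adj′ (inj₂ (_ , q))       = parent-adj q

      deg′≡ : ∀ v → deg′ v ≡ length (rem′ v)
      deg′≡ v with v Fin.≟ u | v Fin.≟ p
      ... | yes refl | _        = trans deg-u (cong length (sym rem′-u))
      ... | no _     | yes refl = trans deg-p (trans (cong (_∸ 1) (trans (deg≡ p) (length-delete (rem! p) u∈)))
                                    (cong length (sym rem′-p)))
      ... | no v≢u   | no v≢p   = trans (deg-v v≢u v≢p) (trans (deg≡ v) (cong length (sym (rem′-v v≢u v≢p))))

      total′≡ : ∀ {v w} → w ∈ rem′ v → total′ v ≡ sum (map toℕ (rem′ v))
      total′≡ {v} w∈ with v Fin.≟ p
      ... | yes refl = trans total-p (trans (cong (_∸ toℕ u) (trans (total≡ u∈) (sum-delete toℕ (rem! p) u∈)))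
                         (trans (ℕ.m+n∸m≡n (toℕ u) _) (cong (sum ∘ map toℕ) (sym rem′-p))))
      ... | no v≢p   = trans (total-v v≢p) (trans (total≡ (rem′⊆ w∈))
                         (cong (sum ∘ map toℕ) (sym (rem′-v (proj₁ (rem′⇒≢ w∈) ∘ sym) v≢p))))

      removed′ : ∀ {v w} → par′ v ≡ just w → rem′ v ≡ []
      removed′ {v} eq with u Fin.≟ v
      ... | yes _ = refl
      ... | no _  = cong (delete u) (removed eq)

      oriented′ : ∀ {v w} → Adj H v w → w ∈ rem′ v ⊎ (par′ v ≡ just w ⊎ par′ w ≡ just v)
      oriented′ {v} {w} a with oriented a
      ... | inj₂ (inj₁ q) = inj₂ (inj₁ (trans (par′-v (λ { refl → not-child q p∈ })) q))
      ... | inj₂ (inj₂ q) = inj₂ (inj₂ (trans (par′-v (λ { refl → not-child q p∈ })) q))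
      ... | inj₁ w∈ with u Fin.≟ v | u Fin.≟ w
      ...   | yes refl | _ with refl ← ∈-rem-u w∈ = inj₂ (inj₁ refl)
      ...   | no _     | yes refl with refl ← ∈-rem-u (reverse w∈) = inj₂ (inj₂ refl)
      ...   | no u≢v   | no u≢w = inj₁ (∈-filter⁺ (u ≢?_) w∈ u≢w)

      label′-p : label′ p ≡ label p ⊔ bump (label u)
      label′-p = trans label-p (m+[n∸m]≡m⊔n (label p) _)

      label′≤2 : ∀ v → label′ v ≤ 2
      label′≤2 v with v Fin.≟ p
      ... | yes refl = subst (_≤ 2) (sym label′-p) (ℕ.⊔-lub (label≤2 p) (bump≤2 (label≤2 u)))
      ... | no v≢p   = subst (_≤ 2) (sym (label-v v≢p)) (label≤2 v)

      label≤label′ : ∀ v → label v ≤ label′ v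
      label≤label′ v with v Fin.≟ p
      ... | yes refl = subst (label p ≤_) (sym label′-p) (ℕ.m≤m⊔n (label p) _)
      ... | no v≢p   = ℕ.≤-reflexive (sym (label-v v≢p))

      dominates′ : ∀ {c v} → (c ≡ u × v ≡ p) ⊎ (u ≢ c × par c ≡ just v) → label′ c < 2 → label′ c < label′ v
      dominates′ (inj₁ (refl , refl)) rewrite label-v u≢p | label′-p = λ <2 →
        ℕ.≤-trans (ℕ.≤-reflexive (sym (bump-suc <2))) (ℕ.m≤n⊔m (label p) _)
      dominates′ {c} {v} (inj₂ (_ , q)) rewrite label-v {c} (λ { refl → not-child q u∈ }) = λ <2 →
        ℕ.≤-trans (dominates q <2) (label≤label′ v)

      old-child : ∀ {v k} → label v ≡ suc k → ∃ λ c → par′ c ≡ just v × label′ c ≡ k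
      old-child eq with c , q , lc ← supported eq =
        c , trans (par′-v (λ { refl → not-child q p∈ })) q , trans (label-v (λ { refl → not-child q u∈ })) lc

      supported′ : ∀ {v k} → label′ v ≡ suc k → ∃ λ c → par′ c ≡ just v × label′ c ≡ k
      supported′ {v} eq with v Fin.≟ p
      ... | no v≢p = old-child (trans (sym (label-v v≢p)) eq)
      -- The maximum is either the old label, whose supporting child persists, or the value forced
      -- by `u`, and then `u` is the child sought.
      ... | yes refl with ℕ.⊔-sel (label p) (bump (label u))
      ...   | inj₁ ≡l = old-child (trans (sym (trans label′-p ≡l)) eq)
      ...   | inj₂ ≡b = u , par′-u ,
        trans (label-v u≢p) (bump-injective (label≤2 u) (trans (sym (trans label′-p ≡b)) eq))

      all-live′ : ∀ {v} → par′ v ≡ nothing → v ∈ delete u live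
      all-live′ {v} eq with u Fin.≟ v
      ... | no u≢v = ∈-filter⁺ (u ≢?_) (all-live eq) u≢v

  complete-pruning : ¬ Cycle H → ∀ {deg total label k} (S : Stage deg total label k) →
                     (∀ v → deg v ≢ 1) → Pruning H (Stage.par S) label
  complete-pruning acyclic S no-leaf = record
    { parent-adj = parent-adj
    ; label≤2    = label≤2
    ; dominates  = dominates
    ; supported  = supported
    ; oriented   = λ a → Sum.[ (λ w∈ → contradiction w∈ no-edge) , (λ o → o) ] (oriented a)
    }
    where
    open Stage S
    no-edge : ∀ {v w} → w ∉ rem v
    no-edge = no-leaf⇒no-edge H acyclic rem sound reverse rem! λ v eq → no-leaf v (trans (deg≡ v) eq)

-- Running the machine

upd-same : ∀ f a {b} → (f [ a ↦ b ]) a ≡ b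
upd-same f a {b} = cong (if_then b else f a) (dec-true (a ℕ.≟ a) refl)

upd-other : ∀ f {a b i} → i ≢ a → (f [ a ↦ b ]) i ≡ f i
upd-other f {a} {b} {i} i≢a = cong (if_then b else f i) (dec-false (i ℕ.≟ a) i≢a)

-- Names the new value up to a proof, so that the states along a run display mathematical values
-- instead of evaluated expressions.
assign= : ∀ {r e s x} → eval e s ≡ x →
          (r ≔ e) ∶ s ⇓[ 1 + cost e ] ⟨ registers s [ r ↦ x ] , memory s ⟩
assign= refl = assign

store= : ∀ {a e s i x} → eval a s ≡ i → eval e s ≡ x →
         (mem[ a ]≔ e) ∶ s ⇓[ 1 + (cost a + cost e) ] ⟨ registers s , memory s [ i ↦ x ] ⟩
store= refl refl = store

Run : Program → State → ℕ → (State → Set) → Set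
Run p s b Q = ∃₂ λ t s′ → (p ∶ s ⇓[ t ] s′) × t ≤ b × Q s′

-- The index of I is a potential out of which every iteration is paid.
while-run : ∀ {e p} (I : ℕ → State → Set) →
            (∀ {k s} → I k s → eval e s ≢ 0 →
               ∃₂ λ b j → Run p s b (I j) × 1 + cost e + b + j ≤ k) →
            ∀ {k s} → I k s →
            Run (whilenz e loop p) s (k + (1 + cost e)) (λ s′ → eval e s′ ≡ 0 × ∃ λ j → I j s′)
while-run {e} {p} I step i = go _ ℕ.≤-refl i
  where
  go : ∀ n {k s} → k ≤ n → I k s →
       Run (whilenz e loop p) s (k + (1 + cost e)) (λ s′ → eval e s′ ≡ 0 × ∃ λ j → I j s′)
  go n {k} {s} k≤n i with eval e s ℕ.≟ 0
  ... | yes e≡0 = _ , _ , while-zero e≡0 , ℕ.m≤n+m _ k , e≡0 , k , i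
  ... | no e≢0 with b , j , (t , s₁ , run , t≤ , i₁) , pays ← step i e≢0 with n
  ...   | zero with () ← ℕ.≤-trans pays k≤n
  ...   | suc n′ with t′ , s₂ , run′ , t′≤ , q ←
            go n′ (ℕ.≤-pred (ℕ.≤-trans (s≤s (ℕ.m≤n+m j _)) (ℕ.≤-trans pays k≤n))) i₁ =
    _ , s₂ , while-nonzero e≢0 run run′ ,
    (begin
      1 + cost e + t + t′                     ≤⟨ ℕ.+-mono-≤ (ℕ.+-monoʳ-≤ (1 + cost e) t≤) t′≤ ⟩
      1 + cost e + b + (j + (1 + cost e))     ≡⟨ ℕ.+-assoc (1 + cost e + b) j _ ⟨
      1 + cost e + b + j + (1 + cost e)       ≤⟨ ℕ.+-monoˡ-≤ _ pays ⟩
      k + (1 + cost e)                        ∎) , q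
    where open ℕ.≤-Reasoning

-- The unread part of the input

Reads : (ℕ → ℕ) → ℕ → ℕ → List ℕ → Set
Reads M B pos []       = pos ≡ B
Reads M B pos (x ∷ xs) = M pos ≡ x × Reads M B (suc pos) xs

reads-length : ∀ {M B pos} xs → Reads M B pos xs → pos + length xs ≡ B
reads-length {pos = pos} []       eq      = trans (ℕ.+-identityʳ pos) eq
reads-length {pos = pos} (x ∷ xs) (_ , r) = trans (ℕ.+-suc pos (length xs)) (reads-length xs r)

reads-< : ∀ {M B pos x} xs → Reads M B pos (x ∷ xs) → pos < B
reads-< {pos = pos} xs (_ , r) = subst (pos <_) (reads-length xs r) (ℕ.m≤m+n (suc pos) (length xs))

-- Covers both kinds of writes: the stack lies below the reading position, the arrays lie from `B`
-- on.
reads-frame : ∀ {M M′ B pos} xs → (∀ {i} → pos ≤ i → i < B → M′ i ≡ M i) →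
              Reads M B pos xs → Reads M′ B pos xs
reads-frame []       f r        = r
reads-frame (x ∷ xs) f r@(eq , r′) =
  trans (f ℕ.≤-refl (reads-< xs r)) eq , reads-frame xs (λ pos< → f (ℕ.<⇒≤ pos<)) r′

reads-contents : ∀ {M B pos} xs → (∀ i → M (pos + i) ≡ contents xs i) →
                 pos + length xs ≡ B → Reads M B pos xs
reads-contents {pos = pos} []       f eq = trans (sym (ℕ.+-identityʳ pos)) eq
reads-contents {M} {pos = pos} (x ∷ xs) f eq =
  trans (cong M (sym (ℕ.+-identityʳ pos))) (f 0) ,
  reads-contents xs (λ i → trans (cong M (sym (ℕ.+-suc pos i))) (f (suc i)))
                 (trans (sym (ℕ.+-suc pos (length xs))) eq)

-- Registers: 0 length of the input, 1 reading position, 2 stack height,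
-- 3 number of vertices of the current leaf, 4 and 5 loop variables,
-- 6 accumulator, 7 parent, 8 tag, 9 label.  The stack overwrites the part of the
-- input already read.  Behind the input lie three arrays indexed by the vertices of
-- the leaf: 0 current degree, 1 sum of the remaining neighbours, 2 label.

addr : Fin 3 → ℕ → Expr
addr 0F r = reg 0 ⊞ reg r
addr 1F r = reg 0 ⊞ reg 3 ⊞ reg r
addr 2F r = reg 0 ⊞ reg 3 ⊞ reg 3 ⊞ reg r

-- `1 ∸ |x - 1|`, with the absolute value as a sum of two truncated differences.
isOneᴱ : Expr → Expr
isOneᴱ x = const 1 ⊟ (x ⊟ const 1 ⊞ (const 1 ⊟ x))

accumulate : Program
accumulate = whilenz reg 5 loop
  (6 ≔ reg 6 ⊞ mem (reg 1) ⨟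
   1 ≔ reg 1 ⊞ const 1 ⨟
   5 ≔ reg 5 ⊟ const 1)

loadLoop : Program
loadLoop = whilenz reg 3 ⊟ reg 4 loop
  (5 ≔ mem (reg 1) ⨟
   mem[ addr 0F 4 ]≔ reg 5 ⨟
   mem[ addr 2F 4 ]≔ const 0 ⨟
   6 ≔ const 0 ⨟
   1 ≔ reg 1 ⊞ const 1 ⨟
   accumulate ⨟
   mem[ addr 1F 4 ]≔ reg 6 ⨟
   4 ≔ reg 4 ⊞ const 1)

advance : Program
advance = 4 ≔ reg 4 ⊞ const 1 ⨟ 5 ≔ reg 4

removeLeaf : Program
removeLeaf =
  7 ≔ mem (addr 1F 5) ⨟
  9 ≔ mem (addr 2F 5) ⨟
  mem[ addr 0F 5 ]≔ const 0 ⨟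
  mem[ addr 0F 7 ]≔ mem (addr 0F 7) ⊟ const 1 ⨟
  mem[ addr 1F 7 ]≔ mem (addr 1F 7) ⊟ reg 5 ⨟
  -- The maximum of the label of the parent and `bump` of the label in register 9.
  mem[ addr 2F 7 ]≔ mem (addr 2F 7) ⊞
    (const 1 ⊞ reg 9 ⊟ (reg 9 ⊟ const 1 ⊞ (reg 9 ⊟ const 1) ⊞ (reg 9 ⊟ const 1)) ⊟ mem (addr 2F 7)) ⨟
  -- Only the parent can have become a leaf, so it is inspected next, even if it lies ahead of the
  -- scanning position.
  5 ≔ reg 7

pruneLoop : Program
pruneLoop = whilenz reg 3 ⊟ reg 4 loop
  (ifnz isOneᴱ (mem (addr 0F 5)) then removeLeaf else advance)

countLoop : Program
countLoop = whilenz reg 3 ⊟ reg 4 loop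
  (6 ≔ reg 6 ⊞ isOneᴱ (mem (addr 2F 4)) ⨟
   4 ≔ reg 4 ⊞ const 1)

leafProgram : Program
leafProgram =
  3 ≔ mem (reg 1) ⨟
  1 ≔ reg 1 ⊞ const 1 ⨟
  4 ≔ const 0 ⨟
  loadLoop ⨟
  4 ≔ const 0 ⨟
  5 ≔ const 0 ⨟
  pruneLoop ⨟
  4 ≔ const 0 ⨟
  6 ≔ const 0 ⨟
  countLoop ⨟
  -- Trees and their complements go through the same loops, which also read past the adjacency
  -- lists; for a complement the count is then replaced by the closed formula.
  (ifnz reg 8 then 6 ≔ const 1 ⊟ (const 3 ⊟ reg 3) else skip) ⨟
  mem[ reg 2 ]≔ reg 6 ⨟
  2 ≔ reg 2 ⊞ const 1

nodeProgram : Program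
nodeProgram =
  2 ≔ reg 2 ⊟ const 1 ⨟
  (ifnz reg 8 ⊟ const 2
    -- Two nested maxima: `a + (b ∸ a)` for the two values on the stack, and `1 + (y ∸ 1)` for the
    -- maximum with 1.
    then mem[ reg 2 ⊟ const 1 ]≔ const 1 ⊞
      (mem (reg 2 ⊟ const 1) ⊞ (mem (reg 2) ⊟ mem (reg 2 ⊟ const 1)) ⊟ const 1)
    else mem[ reg 2 ⊟ const 1 ]≔ mem (reg 2 ⊟ const 1) ⊞ mem (reg 2))

mainBody : Program
mainBody =
  8 ≔ mem (reg 1) ⨟
  1 ≔ reg 1 ⊞ const 1 ⨟
  (ifnz reg 8 ⊟ const 1 then nodeProgram else leafProgram)

mainLoop : Program
mainLoop = whilenz reg 0 ⊟ reg 1 loop mainBody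

program : Program
-- After the loop the stack holds a single value, at its bottom in cell 0.
program = mainLoop ⨟ 0 ≔ mem (const 0)

isOne : ℕ → ℕ
isOne x = 1 ∸ (x ∸ 1 + (1 ∸ x))

isOne≡0 : ∀ {x} → x ≢ 1 → isOne x ≡ 0
isOne≡0 {zero}        _  = refl
isOne≡0 {suc zero}    ≢1 = contradiction refl ≢1
isOne≡0 {suc (suc x)} _  = ℕ.0∸n≡0 (x + 0)

-- Correctness and cost of the program at a leaf

module Leaf (B m sp tag : ℕ) (M₀ : ℕ → ℕ) where

  cell : Fin 3 → ℕ → ℕ
  cell 0F x = B + x
  cell 1F x = B + m + x
  cell 2F x = B + m + m + x

  -- The three arrays are one array indexed by `combine`, so the cells of different arrays or
  -- vertices differ because `combine` is injective.
  cell-combine : ∀ k (v : Fin m) → cell k (toℕ v) ≡ B + toℕ (combine k v)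
  cell-combine k v = trans (go k) (cong (B +_) (sym (Fin.toℕ-combine k v)))
    where
    go : ∀ k → cell k (toℕ v) ≡ B + (m * toℕ k + toℕ v)
    go 0F = cong (λ z → B + (z + toℕ v)) (sym (ℕ.*-zeroʳ m))
    go 1F = trans (ℕ.+-assoc B m _) (cong (λ z → B + (z + toℕ v)) (sym (ℕ.*-identityʳ m)))
    go 2F = trans (cong (_+ toℕ v) (ℕ.+-assoc B m m)) (trans (ℕ.+-assoc B (m + m) _)
      (cong (λ z → B + (z + toℕ v)) (trans (cong (m +_) (sym (ℕ.+-identityʳ m))) (ℕ.*-comm 2 m))))

  B≤cell : ∀ k x → B ≤ cell k x
  B≤cell 0F x = ℕ.m≤m+n B x
  B≤cell 1F x = ℕ.≤-trans (ℕ.m≤m+n B m) (ℕ.m≤m+n _ x)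
  B≤cell 2F x = ℕ.≤-trans (ℕ.m≤m+n B m) (ℕ.≤-trans (ℕ.m≤m+n _ m) (ℕ.m≤m+n _ x))

  view : (ℕ → ℕ) → Fin 3 → Fin m → ℕ
  view M k v = M (cell k (toℕ v))

  cell-injective : ∀ k l (v w : Fin m) → cell k (toℕ v) ≡ cell l (toℕ w) → k ≡ l × v ≡ w
  cell-injective k l v w eq = Fin.combine-injective k v l w (Fin.toℕ-injective
    (ℕ.+-cancelˡ-≡ B _ _ (trans (sym (cell-combine k v)) (trans eq (cell-combine l w)))))

  other-array : ∀ M k l (v w : Fin m) {x} → l ≢ k → view (M [ cell k (toℕ v) ↦ x ]) l w ≡ view M l w
  other-array M k l v w l≢k = upd-other M (l≢k ∘ proj₁ ∘ cell-injective l k w v)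

  other-vertex : ∀ M k l (v w : Fin m) {x} → w ≢ v → view (M [ cell k (toℕ v) ↦ x ]) l w ≡ view M l w
  other-vertex M k l v w w≢v = upd-other M (w≢v ∘ proj₂ ∘ cell-injective l k w v)

  Regs : (ℕ → ℕ) → Set
  Regs R = R 0 ≡ B × R 2 ≡ sp × R 3 ≡ m × R 8 ≡ tag

  Below : (ℕ → ℕ) → Set
  Below M = ∀ {i} → i < B → M i ≡ M₀ i

  below-cell : ∀ {M} k x {y} → Below M → Below (M [ cell k x ↦ y ])
  below-cell {M} k x b i<B = trans (upd-other M λ { refl → ℕ.<⇒≱ i<B (B≤cell k x) }) (b i<B)

  eval-addr : ∀ k r s {x} → Regs (registers s) → registers s r ≡ x → eval (addr k r) s ≡ cell k x
  eval-addr 0F r s (r0 , _) eq = cong₂ _+_ r0 eq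
  eval-addr 1F r s (r0 , _ , r3 , _) eq = cong₂ _+_ (cong₂ _+_ r0 r3) eq
  eval-addr 2F r s (r0 , _ , r3 , _) eq = cong₂ _+_ (cong₂ _+_ (cong₂ _+_ r0 r3) r3) eq

  store-cell : ∀ k r {e s x y} → Regs (registers s) → registers s r ≡ x → eval e s ≡ y →
    (mem[ addr k r ]≔ e) ∶ s ⇓[ 1 + (cost (addr k r) + cost e) ]
      ⟨ registers s , memory s [ cell k x ↦ y ] ⟩
  store-cell k r {s = s} regs eq = store= (eval-addr k r s regs eq)

  accumulate-run : ∀ xs {rest s} → registers s 5 ≡ length xs →
    Reads M₀ B (registers s 1) (xs ++ rest) → Regs (registers s) → Below (memory s) →
    Run accumulate s (15 * length xs + 2) λ s′ →
      Regs (registers s′) × registers s′ 4 ≡ registers s 4 × memory s′ ≡ memory s ×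
      registers s′ 6 ≡ registers s 6 + sum xs × Reads M₀ B (registers s′ 1) rest
  accumulate-run [] {s = s} r5 reads regs _ =
    _ , s , while-zero r5 , ℕ.≤-refl , regs , refl , refl , sym (ℕ.+-identityʳ _) , reads
  accumulate-run (x ∷ xs) {rest} {s} r5 reads@(eq , reads′) regs below
    with t , s′ , run , t≤ , regs′ , r4 , mem≡ , r6 , reads″ ← accumulate-run xs
      {s = ⟨ registers s [ 6 ↦ registers s 6 + x ] [ 1 ↦ suc (registers s 1) ] [ 5 ↦ length xs ] , memory s ⟩}
      refl reads′ regs below =
    _ , s′ , while-nonzero (λ z → contradiction (trans (sym r5) z) λ ())
      (seq (assign= (cong (registers s 6 +_) (trans (below (reads-< (xs ++ rest) reads)) eq)))
      (seq (assign= (ℕ.+-comm (registers s 1) 1))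
           (assign= (cong (_∸ 1) r5)))) run ,
    (begin
      15 + t                        ≤⟨ ℕ.+-monoʳ-≤ 15 t≤ ⟩
      15 + (15 * length xs + 2)     ≡⟨ ℕ.+-assoc 15 (15 * length xs) 2 ⟨
      15 + 15 * length xs + 2       ≡⟨ cong (_+ 2) (ℕ.*-suc 15 (length xs)) ⟨
      15 * suc (length xs) + 2      ∎) ,
    regs′ , r4 , mem≡ , trans r6 (ℕ.+-assoc (registers s 6) x (sum xs)) , reads″
    where open ℕ.≤-Reasoning

  -- Ties the loop counter in register 4 to a recursion over the corresponding tail of `allFin m`.
  From : ℕ → List (Fin m) → Set
  From k []       = k ≡ m
  From k (v ∷ vs) = toℕ v ≡ k × From (suc k) vs

  from-allFin : From 0 (allFin m)
  from-allFin = go m 0 (λ i → i) (λ _ → refl) refl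
    where
    go : ∀ j k (f : Fin j → Fin m) → (∀ i → toℕ (f i) ≡ k + toℕ i) → k + j ≡ m → From k (tabulate f)
    go zero    k f f≡ eq = trans (sym (ℕ.+-identityʳ k)) eq
    go (suc j) k f f≡ eq = trans (f≡ zero) (ℕ.+-identityʳ k) ,
      go j (suc k) (f ∘ suc) (λ i → trans (f≡ (suc i)) (ℕ.+-suc k (toℕ i))) (trans (sym (ℕ.+-suc k j)) eq)

  more : ∀ {s} {v : Fin m} → Regs (registers s) → registers s 4 ≡ toℕ v → eval (reg 3 ⊟ reg 4) s ≢ 0
  more {v = v} (_ , _ , r3 , _) r4 eq = ℕ.<⇒≱ (Fin.toℕ<n v)
    (ℕ.m∸n≡0⇒m≤n (trans (sym (cong₂ _∸_ r3 r4)) eq))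

  finished : ∀ {s} → Regs (registers s) → registers s 4 ≡ m → eval (reg 3 ⊟ reg 4) s ≡ 0
  finished (_ , _ , r3 , _) r4 = trans (cong₂ _∸_ r3 r4) (ℕ.n∸n≡0 m)

  module _ (neighbours : Fin m → List (Fin m)) where

    block : Fin m → List ℕ
    block v = length (neighbours v) ∷ map toℕ (neighbours v)

    LoadedAt : (ℕ → ℕ) → Fin m → Set
    LoadedAt M v = view M 0F v ≡ length (neighbours v) ×
                   view M 1F v ≡ sum (map toℕ (neighbours v)) × view M 2F v ≡ 0

    load-step : ∀ M {v} → (∀ w → toℕ w < toℕ v → LoadedAt M w) →
      ∀ w → toℕ w < suc (toℕ v) →
      LoadedAt (M [ cell 0F (toℕ v) ↦ length (neighbours v) ] [ cell 2F (toℕ v) ↦ 0 ]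
                  [ cell 1F (toℕ v) ↦ sum (map toℕ (neighbours v)) ]) w
    load-step M {v} loaded w (s≤s w≤v) with w Fin.≟ v
    ... | yes refl =
      trans (other-array M₂ 1F 0F v v λ ()) (trans (other-array M₁ 2F 0F v v λ ()) (upd-same M (cell 0F (toℕ v)))) ,
      upd-same M₂ (cell 1F (toℕ v)) ,
      trans (other-array M₂ 1F 2F v v λ ()) (upd-same M₁ (cell 2F (toℕ v)))
      where
      M₁ = M [ cell 0F (toℕ v) ↦ length (neighbours v) ]
      M₂ = M₁ [ cell 2F (toℕ v) ↦ 0 ]
    ... | no w≢v with l₀ , l₁ , l₂ ← loaded w (ℕ.≤∧≢⇒< w≤v (w≢v ∘ Fin.toℕ-injective)) =
      trans (unchanged 0F) l₀ , trans (unchanged 1F) l₁ , trans (unchanged 2F) l₂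
      where
      M₁ = M [ cell 0F (toℕ v) ↦ length (neighbours v) ]
      M₂ = M₁ [ cell 2F (toℕ v) ↦ 0 ]
      unchanged : ∀ l → view (M₂ [ cell 1F (toℕ v) ↦ sum (map toℕ (neighbours v)) ]) l w ≡ view M l w
      unchanged l = trans (other-vertex M₂ 1F l v w w≢v) (trans (other-vertex M₁ 2F l v w w≢v) (other-vertex M 0F l v w w≢v))

    load-run : ∀ vs {k rest s} → From k vs → registers s 4 ≡ k →
      Reads M₀ B (registers s 1) (concatMap block vs ++ rest) →
      Regs (registers s) → Below (memory s) → (∀ v → toℕ v < k → LoadedAt (memory s) v) →
      Run loadLoop s (40 * length (concatMap block vs) + 4) λ s′ →
        Regs (registers s′) × Below (memory s′) × (∀ v → LoadedAt (memory s′) v) ×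
        Reads M₀ B (registers s′ 1) rest
    load-run [] {s = s} refl r4 reads regs below loaded =
      _ , s , while-zero (finished {s} regs r4) , ℕ.≤-refl , regs , below ,
      (λ v → loaded v (Fin.toℕ<n v)) , reads
    load-run (v ∷ vs) {k} {rest} {s} (refl , from) r4 reads@(eq , reads₀) regs below loaded
      with t₁ , ⟨ R₁ , _ ⟩ , run₁ , t₁≤ , regs₁ , r4₁ , refl , r6₁ , reads₁ ←
        accumulate-run (map toℕ (neighbours v))
          {s = ⟨ registers s [ 5 ↦ length (neighbours v) ] [ 6 ↦ 0 ] [ 1 ↦ suc (registers s 1) ] ,
                 memory s [ cell 0F (toℕ v) ↦ length (neighbours v) ] [ cell 2F (toℕ v) ↦ 0 ] ⟩}
          (sym (List.length-map toℕ (neighbours v)))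
          (subst (Reads M₀ B _) (List.++-assoc (map toℕ (neighbours v)) _ rest) reads₀)
          regs (below-cell 2F (toℕ v) (below-cell 0F (toℕ v) below))
      with t , s′ , run , t≤ , post ← load-run vs {suc k}
          {s = ⟨ R₁ [ 4 ↦ suc k ] ,
                 memory s [ cell 0F (toℕ v) ↦ length (neighbours v) ] [ cell 2F (toℕ v) ↦ 0 ]
                          [ cell 1F (toℕ v) ↦ sum (map toℕ (neighbours v)) ] ⟩}
          from refl reads₁ regs₁
          (below-cell 1F (toℕ v) (below-cell 2F (toℕ v) (below-cell 0F (toℕ v) below)))
          (load-step (memory s) loaded) =
      _ , s′ , while-nonzero (more {s} regs r4)
        (seq (assign= (trans (below (reads-< ((map toℕ (neighbours v) ++ concatMap block vs) ++ rest) reads)) eq))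
        (seq (store-cell 0F 4 regs r4 refl)
        (seq (store-cell 2F 4 regs r4 refl)
        (seq (assign= refl)
        (seq (assign= (ℕ.+-comm (registers s 1) 1))
        (seq run₁
        (seq (store-cell 1F 4 regs₁ (trans r4₁ r4) r6₁)
             (assign= (trans (cong (_+ 1) (trans r4₁ r4)) (ℕ.+-comm k 1))))))))))
        run , time , post
      where
      d = length (neighbours v)
      n = length (concatMap block vs)
      length≡ : length (map toℕ (neighbours v) ++ concatMap block vs) ≡ d + n
      length≡ = trans (List.length-++ (map toℕ (neighbours v))) (cong (_+ n) (List.length-map toℕ (neighbours v)))
      -- A vertex costs 40 and each entry of its list 15; charging 40 for every number of the block
      -- covers both.
      time : 27 + (t₁ + 11) + t ≤ 40 * suc (length (map toℕ (neighbours v) ++ concatMap block vs)) + 4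
      time = begin
        27 + (t₁ + 11) + t                   ≤⟨ ℕ.+-mono-≤ (ℕ.+-monoʳ-≤ 27 (ℕ.+-monoˡ-≤ 11 (ℕ.≤-trans t₁≤ (ℕ.≤-reflexive (cong (λ l → 15 * l + 2) (List.length-map toℕ (neighbours v))))))) t≤ ⟩
        27 + (15 * d + 2 + 11) + (40 * n + 4) ≡⟨ shuffle d n ⟩
        40 + 40 * n + 4 + 15 * d              ≤⟨ ℕ.+-monoʳ-≤ (40 + 40 * n + 4) (ℕ.*-monoˡ-≤ d (from-yes (15 ≤? 40))) ⟩
        40 + 40 * n + 4 + 40 * d              ≡⟨ collect d n ⟩
        40 * suc (d + n) + 4                  ≡⟨ cong (λ l → 40 * suc l + 4) length≡ ⟨
        40 * suc (length (map toℕ (neighbours v) ++ concatMap block vs)) + 4 ∎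
        where
        open ℕ.≤-Reasoning
        shuffle : ∀ d n → 27 + (15 * d + 2 + 11) + (40 * n + 4) ≡ 40 + 40 * n + 4 + 15 * d
        shuffle = solve-∀
        collect : ∀ d n → 40 + 40 * n + 4 + 40 * d ≡ 40 * suc (d + n) + 4
        collect = solve-∀

  module _ (H : Graph (Fin m)) (pos : ℕ) where

    StageAt : (ℕ → ℕ) → ℕ → Set
    StageAt M = Stage H (view M 0F) (view M 1F) (view M 2F)

    -- Every vertex up to the scanning position (register 4) other than the
    -- cursor (register 5) is known not to be a leaf.
    record Scan (k : ℕ) (s : State) : Set where
      field
        {a}    : ℕ
        -- Both kinds of step cost at most 110, and each lowers the second factor
        -- by one: a is the number of vertices that have not been removed.
        k≡     : k ≡ 110 * (m ∸ registers s 4 + a)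
        regs   : Regs (registers s)
        r1     : registers s 1 ≡ pos
        below  : Below (memory s)
        cursor : (registers s 4 < m × registers s 5 < m) ⊎ (registers s 4 ≡ m × registers s 5 ≡ m)
        stage  : StageAt (memory s) a
        clear  : ∀ x → toℕ x ≤ registers s 4 → view (memory s) 0F x ≡ 1 → toℕ x ≡ registers s 5

    removal : ∀ M {u p : Fin m} → u ≢ p →
      let M′ = M [ cell 0F (toℕ u) ↦ 0 ] [ cell 0F (toℕ p) ↦ view M 0F p ∸ 1 ]
                 [ cell 1F (toℕ p) ↦ view M 1F p ∸ toℕ u ]
                 [ cell 2F (toℕ p) ↦ view M 2F p + (bump (view M 2F u) ∸ view M 2F p) ] in
      Removal H (view M 0F) (view M 1F) (view M 2F) (view M′ 0F) (view M′ 1F) (view M′ 2F) u p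
    removal M {u} {p} u≢p = record
      { deg-u   = trans (late 0F u (λ ()) (λ ())) (trans (other-vertex M₁ 0F 0F p u u≢p) (upd-same M (cell 0F (toℕ u))))
      ; deg-p   = trans (late 0F p (λ ()) (λ ())) (upd-same M₁ (cell 0F (toℕ p)))
      ; deg-v   = λ {v} v≢u v≢p → trans (late 0F v (λ ()) (λ ()))
                    (trans (other-vertex M₁ 0F 0F p v v≢p) (other-vertex M 0F 0F u v v≢u))
      ; total-p = trans (other-array M₃ 2F 1F p p λ ()) (upd-same M₂ (cell 1F (toℕ p)))
      ; total-v = λ {v} v≢p → trans (other-array M₃ 2F 1F p v λ ())
                    (trans (other-vertex M₂ 1F 1F p v v≢p) (early 1F v λ ()))
      ; label-p = upd-same M₃ (cell 2F (toℕ p))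
      ; label-v = λ {v} v≢p → trans (other-vertex M₃ 2F 2F p v v≢p)
                    (trans (other-array M₂ 1F 2F p v λ ()) (early 2F v λ ()))
      }
      where
      M₁ = M [ cell 0F (toℕ u) ↦ 0 ]
      M₂ = M₁ [ cell 0F (toℕ p) ↦ view M 0F p ∸ 1 ]
      M₃ = M₂ [ cell 1F (toℕ p) ↦ view M 1F p ∸ toℕ u ]
      M₄ = M₃ [ cell 2F (toℕ p) ↦ view M 2F p + (bump (view M 2F u) ∸ view M 2F p) ]
      early : ∀ k v → k ≢ 0F → view M₂ k v ≡ view M k v
      early k v k≢0 = trans (other-array M₁ 0F k p v k≢0) (other-array M 0F k u v k≢0)
      late : ∀ k v → k ≢ 1F → k ≢ 2F → view M₄ k v ≡ view M₂ k v
      late k v k≢1 k≢2 = trans (other-array M₃ 2F k p v k≢2) (other-array M₂ 1F k p v k≢1)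

    removeLeaf-run : ∀ {s} {u p : Fin m} → Regs (registers s) → registers s 5 ≡ toℕ u →
      view (memory s) 1F u ≡ toℕ p → u ≢ p →
      removeLeaf ∶ s ⇓[ 88 ]
        ⟨ registers s [ 7 ↦ toℕ p ] [ 9 ↦ view (memory s) 2F u ] [ 5 ↦ toℕ p ] ,
          memory s [ cell 0F (toℕ u) ↦ 0 ] [ cell 0F (toℕ p) ↦ view (memory s) 0F p ∸ 1 ]
            [ cell 1F (toℕ p) ↦ view (memory s) 1F p ∸ toℕ u ]
            [ cell 2F (toℕ p) ↦ view (memory s) 2F p + (bump (view (memory s) 2F u) ∸ view (memory s) 2F p) ] ⟩
    removeLeaf-run {s} {u} {p} regs r5 total≡p u≢p =
      seq (assign= (trans (cong M (eval-addr 1F 5 s regs r5)) total≡p))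
      (seq (assign= (cong M (eval-addr 2F 5 ⟨ R₇ , M ⟩ regs r5)))
      (seq (store-cell 0F 5 regs r5 refl)
      (seq (store-cell 0F 7 regs refl (cong (_∸ 1)
        (trans (cong M₁ (eval-addr 0F 7 ⟨ R₉ , M₁ ⟩ regs refl)) (other-vertex M 0F 0F u p (u≢p ∘ sym)))))
      (seq (store-cell 1F 7 regs refl (cong₂ _∸_
        (trans (cong M₂ (eval-addr 1F 7 ⟨ R₉ , M₂ ⟩ regs refl))
          (trans (other-array M₁ 0F 1F p p λ ()) (other-array M 0F 1F u p λ ()))) r5))
      (seq (store-cell 2F 7 regs refl (cong (λ l → l + (bump (view M 2F u) ∸ l))
        (trans (cong M₃ (eval-addr 2F 7 ⟨ R₉ , M₃ ⟩ regs refl))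
          (trans (other-array M₂ 1F 2F p p λ ())
          (trans (other-array M₁ 0F 2F p p λ ()) (other-array M 0F 2F u p λ ()))))))
        assign)))))
      where
      M = memory s
      R₇ = registers s [ 7 ↦ toℕ p ]
      R₉ = R₇ [ 9 ↦ view M 2F u ]
      M₁ = M [ cell 0F (toℕ u) ↦ 0 ]
      M₂ = M₁ [ cell 0F (toℕ p) ↦ view M 0F p ∸ 1 ]
      M₃ = M₂ [ cell 1F (toℕ p) ↦ view M 1F p ∸ toℕ u ]

    -- Removing the leaf at the cursor lowers the degrees of `u` and `p` only: `u` drops to 0 and
    -- `p` becomes the cursor. If the cursor is not a leaf, no vertex up to the scanning position is
    -- one, and the next position becomes the cursor. With the loop test these steps cost 108 and
    -- 26.
    scan-step : ∀ {k s} → Scan k s → eval (reg 3 ⊟ reg 4) s ≢ 0 →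
      ∃₂ λ b j → Run (ifnz isOneᴱ (mem (addr 0F 5)) then removeLeaf else advance) s b (Scan j) ×
        4 + b + j ≤ k
    scan-step {s = s} I continue with Scan.cursor I
    ... | inj₂ (r4≡m , _) = contradiction (finished {s} (Scan.regs I) r4≡m) continue
    ... | inj₁ (v<m , y<m) = go (view M 0F u ℕ.≟ 1)
      where
      open Scan I
      M = memory s
      v = registers s 4
      u : Fin m
      u = fromℕ< y<m

      r5 : registers s 5 ≡ toℕ u
      r5 = sym (Fin.toℕ-fromℕ< y<m)

      deg-u : eval (mem (addr 0F 5)) s ≡ view M 0F u
      deg-u = cong M (eval-addr 0F 5 s regs r5)

      go : _ → _
      go (yes deg≡1) = 104 , 110 * (m ∸ v + k′) ,
        (104 , _ , if-nonzero (λ z → contradiction (trans (sym (cong isOne (trans deg-u deg≡1))) z) λ ())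
                    (removeLeaf-run regs r5 total≡p u≢p) , ℕ.≤-refl ,
         record
           { k≡     = refl
           ; regs   = regs
           ; r1     = r1
           ; below  = below-cell 2F (toℕ p) (below-cell 1F (toℕ p) (below-cell 0F (toℕ p) (below-cell 0F (toℕ u) below)))
           ; cursor = inj₁ (v<m , Fin.toℕ<n p)
           ; stage  = remove updates
           ; clear  = clear′
           }) ,
        (begin
          108 + 110 * (m ∸ v + k′)   ≤⟨ ℕ.+-monoˡ-≤ (110 * (m ∸ v + k′)) (from-yes (108 ≤? 110)) ⟩
          110 + 110 * (m ∸ v + k′)   ≡⟨ ℕ.*-suc 110 (m ∸ v + k′) ⟨
          110 * suc (m ∸ v + k′)     ≡⟨ cong (110 *_) (trans (cong (m ∸ v +_) a≡) (ℕ.+-suc (m ∸ v) k′)) ⟨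
          110 * (m ∸ v + a)          ≡⟨ k≡ ⟨
          _                          ∎)
        where
        open ℕ.≤-Reasoning
        open Removable (removable H stage deg≡1) renaming (k≡ to a≡)
        updates = removal M u≢p
        clear′ : ∀ x → toℕ x ≤ v → _ → toℕ x ≡ toℕ p
        clear′ x x≤v deg′≡1 with x Fin.≟ p | x Fin.≟ u
        ... | yes refl | _ = refl
        ... | no _ | yes refl = contradiction (trans (sym (Removal.deg-u updates)) deg′≡1) λ ()
        ... | no x≢p | no x≢u = contradiction
          (Fin.toℕ-injective (trans (clear x x≤v (trans (sym (Removal.deg-v updates x≢u x≢p)) deg′≡1)) r5)) x≢u
      go (no deg≢1) = 22 , 110 * (m ∸ suc v + a) ,
        (22 , _ , if-zero (trans (cong isOne deg-u) (isOne≡0 deg≢1))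
                   (seq (assign= (ℕ.+-comm v 1)) assign) , ℕ.≤-refl ,
         record
           { k≡     = refl
           ; regs   = regs
           ; r1     = r1
           ; below  = below
           ; cursor = Sum.map (λ <m → <m , <m) (λ ≡m → ≡m , ≡m) (ℕ.m≤n⇒m<n∨m≡n v<m)
           ; stage  = stage
           ; clear  = clear′
           }) ,
        (begin
          26 + 110 * (m ∸ suc v + a)    ≤⟨ ℕ.+-monoˡ-≤ (110 * (m ∸ suc v + a)) (from-yes (26 ≤? 110)) ⟩
          110 + 110 * (m ∸ suc v + a)   ≡⟨ ℕ.*-suc 110 (m ∸ suc v + a) ⟨
          110 * suc (m ∸ suc v + a)     ≡⟨ cong (λ z → 110 * (z + a)) (ℕ.+-∸-assoc 1 v<m) ⟨
          110 * (m ∸ v + a)             ≡⟨ k≡ ⟨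
          _                             ∎)
        where
        open ℕ.≤-Reasoning
        clear′ : ∀ x → toℕ x ≤ suc v → view M 0F x ≡ 1 → toℕ x ≡ suc v
        clear′ x x≤ deg≡1 with ℕ.m≤n⇒m<n∨m≡n x≤
        ... | inj₂ x≡ = x≡
        ... | inj₁ (s≤s x≤v) = contradiction
          (trans (cong (view M 0F) (sym (Fin.toℕ-injective (trans (clear x x≤v deg≡1) r5)))) deg≡1) deg≢1

    prune-run : ∀ {s} → ¬ Cycle H → 0 < m → Regs (registers s) → Below (memory s) →
      registers s 4 ≡ 0 → registers s 5 ≡ 0 → registers s 1 ≡ pos → StageAt (memory s) m →
      Run pruneLoop s (110 * (m + m) + 4) λ s′ → Regs (registers s′) × Below (memory s′) ×
        registers s′ 1 ≡ pos × ∃ λ par → Pruning H par (view (memory s′) 2F)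
    prune-run {s} acyclic 0<m regs below r4 r5 r1 stage
      with t , s′ , run , t≤ , stop , _ , I ← while-run Scan scan-step {s = s} (record
        { k≡     = cong (λ v → 110 * (m ∸ v + m)) (sym r4)
        ; regs   = regs
        ; r1     = r1
        ; below  = below
        ; cursor = inj₁ (subst (_< m) (sym r4) 0<m , subst (_< m) (sym r5) 0<m)
        ; stage  = stage
        ; clear  = λ x x≤ _ → trans (ℕ.n≤0⇒n≡0 (subst (toℕ x ≤_) r4 x≤)) (sym r5)
        })
      with Scan.cursor I
    ... | inj₁ (v<m , _) = contradiction
      (trans (cong (_∸ registers s′ 4) (sym (proj₁ (proj₂ (proj₂ (Scan.regs I)))))) stop) (ℕ.m>n⇒m∸n≢0 v<m)
    -- All vertices have been scanned, and the exceptional cursor `m` is no vertex; so no vertex has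
    -- degree 1.
    ... | inj₂ (v≡m , y≡m) = t , s′ , run , t≤ , Scan.regs I , Scan.below I , Scan.r1 I , _ ,
      complete-pruning H acyclic (Scan.stage I) λ x deg≡1 →
        ℕ.<⇒≢ (Fin.toℕ<n x) (trans (Scan.clear I x (ℕ.<⇒≤ (subst (toℕ x <_) (sym v≡m) (Fin.toℕ<n x))) deg≡1) y≡m)

  count-run : ∀ vs {k s} → From k vs → registers s 4 ≡ k → Regs (registers s) →
    Run countLoop s (34 * length vs + 4) λ s′ → Regs (registers s′) × memory s′ ≡ memory s ×
      registers s′ 1 ≡ registers s 1 ×
      registers s′ 6 ≡ registers s 6 + length (filter (λ v → view (memory s) 2F v ℕ.≟ 1) vs)
  count-run [] {s = s} refl r4 regs =
    _ , s , while-zero (finished {s} regs r4) , ℕ.≤-refl , regs , refl , refl , sym (ℕ.+-identityʳ _)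
  count-run (v ∷ vs) {k} {s} (refl , from) r4 regs
    with t , s′ , run , t≤ , regs′ , mem≡ , r1 , r6 ← count-run vs {suc k}
      {⟨ registers s [ 6 ↦ registers s 6 + isOne (view (memory s) 2F v) ] [ 4 ↦ suc k ] , memory s ⟩}
      from refl regs =
    _ , s′ , while-nonzero (more {s} regs r4)
      (seq (assign= (cong (λ l → registers s 6 + isOne l) (cong (memory s) (eval-addr 2F 4 s regs r4))))
           (assign= (trans (cong (_+ 1) r4) (ℕ.+-comm k 1)))) run ,
    (begin
      34 + t                       ≤⟨ ℕ.+-monoʳ-≤ 34 t≤ ⟩
      34 + (34 * length vs + 4)    ≡⟨ ℕ.+-assoc 34 (34 * length vs) 4 ⟨
      34 + 34 * length vs + 4      ≡⟨ cong (_+ 4) (ℕ.*-suc 34 (length vs)) ⟨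
      34 * suc (length vs) + 4     ∎) ,
    regs′ , mem≡ , r1 , trans r6 (trans (ℕ.+-assoc (registers s 6) _ _) (cong (registers s 6 +_) (count-head (view (memory s) 2F))))
    where
    open ℕ.≤-Reasoning
    count-head : ∀ (label : Fin m → ℕ) → isOne (label v) + length (filter (λ v → label v ℕ.≟ 1) vs) ≡
                 length (filter (λ v → label v ℕ.≟ 1) (v ∷ vs))
    count-head label = go (label v ℕ.≟ 1)
      where
      ones = filter (λ v → label v ℕ.≟ 1)
      go : _ → _
      go (yes eq) = trans (cong (λ l → isOne l + length (ones vs)) eq)
        (cong length (sym (List.filter-accept (λ v → label v ℕ.≟ 1) {v} {vs} eq)))
      go (no ≢1)  = trans (cong (_+ length (ones vs)) (isOne≡0 ≢1))
        (cong length (sym (List.filter-reject (λ v → label v ℕ.≟ 1) {v} {vs} ≢1)))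

  result-run : ∀ κ {H isTree s} → tag ≡ leafTag κ → Regs (registers s) →
    IsMaxInducedMatchingSize H (registers s 6) →
    Run (ifnz reg 8 then 6 ≔ const 1 ⊟ (const 3 ⊟ reg 3) else skip) s 8 λ s′ →
      Regs (registers s′) × memory s′ ≡ memory s × registers s′ 1 ≡ registers s 1 ×
      IsMaxInducedMatchingSize (evaluate (leaf κ {m} H isTree)) (registers s′ 6)
  result-run tree refl regs@(_ , _ , _ , r8) max =
    _ , _ , if-zero r8 skip , from-yes (3 ≤? 8) , regs , refl , refl , max
  result-run cotree {H} {isTree} refl regs@(_ , _ , r3 , r8) _ =
    _ , _ , if-nonzero (λ z → contradiction (trans (sym r8) z) λ ()) (assign= (cong (λ l → 1 ∸ (3 ∸ l)) r3)) ,
    ℕ.≤-refl , regs , refl , refl , cotree-isMax H isTree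

LeafResult : ∀ κ {m} (H : Graph (Fin m)) → IsTree H → List ℕ → State → State → Set
LeafResult κ H isTree rest s s′ =
  registers s′ 0 ≡ registers s 0 × registers s′ 2 ≡ suc (registers s 2) ×
  Reads (memory s′) (registers s 0) (registers s′ 1) rest ×
  (∀ {i} → i < registers s 2 → memory s′ i ≡ memory s i) ×
  IsMaxInducedMatchingSize (evaluate (leaf κ H isTree)) (memory s′ (registers s 2))

module _ {m} {H : Graph (Fin m)} (isTree : IsTree H) (A : AdjacencyLists H) (s : State) where
  open AdjacencyLists A
  open Leaf (registers s 0) m (registers s 2) (registers s 8) (memory s)

  leaf-run : ∀ κ {rest} → registers s 8 ≡ leafTag κ →
    Reads (memory s) (registers s 0) (registers s 1) (m ∷ word ++ rest) →
    suc (registers s 2) + length rest ≤ registers s 0 →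
    Run leafProgram s (450 * m) (LeafResult κ H isTree rest s)
  leaf-run κ {rest} tag≡ (m≡ , reads) room
    with t₁ , s₁ , run₁ , t₁≤ , regs₁ , below₁ , loaded , reads₁ ←
      load-run neighbours (allFin m) {rest = rest}
        {s = ⟨ registers s [ 3 ↦ m ] [ 1 ↦ suc (registers s 1) ] [ 4 ↦ 0 ] , memory s ⟩}
        from-allFin refl reads (refl , refl , refl , refl) (λ _ → refl) (λ _ ())
    with t₂ , s₂ , run₂ , t₂≤ , regs₂ , below₂ , r1₂ , par , pruning ←
      prune-run H (registers s₁ 1) {⟨ registers s₁ [ 4 ↦ 0 ] [ 5 ↦ 0 ] , memory s₁ ⟩}
        (IsTree.acyclic isTree) (1≤size (leaf κ H isTree)) regs₁ below₁ refl refl refl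
        (initial H A (proj₁ ∘ loaded) (proj₁ ∘ proj₂ ∘ loaded) (proj₂ ∘ proj₂ ∘ loaded))
    with t₃ , s₃ , run₃ , t₃≤ , regs₃ , mem₃ , r1₃ , r6₃ ←
      count-run (allFin m) {s = ⟨ registers s₂ [ 4 ↦ 0 ] [ 6 ↦ 0 ] , memory s₂ ⟩}
        from-allFin refl regs₂
    with t₄ , s₄ , run₄ , t₄≤ , regs₄ , mem₄ , r1₄ , max ←
      result-run κ {H} {isTree} {s₃} tag≡ regs₃
        (subst (IsMaxInducedMatchingSize H) (sym r6₃) (heads-max H pruning)) =
    _ , _ ,
    seq (assign= m≡) (seq (assign= (ℕ.+-comm (registers s 1) 1)) (seq assign (seq run₁
    (seq assign (seq assign (seq run₂ (seq assign (seq assign (seq run₃ (seq run₄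
    (seq (store= (proj₁ (proj₂ regs₄)) refl)
         (assign= (trans (cong (_+ 1) (proj₁ (proj₂ regs₄))) (ℕ.+-comm (registers s 2) 1)))))))))))))) ,
    time , proj₁ regs₄ , refl ,
    reads-frame rest
      (λ r1≤i i<B → trans (upd-other (memory s₄) (ℕ.<⇒≢ (ℕ.<-≤-trans sp<r1 r1≤i) ∘ sym)) (below₄ i<B))
      reads₄ ,
    (λ i<sp → trans (upd-other (memory s₄) (ℕ.<⇒≢ i<sp)) (below₄ (ℕ.<-trans i<sp sp<B))) ,
    subst (IsMaxInducedMatchingSize (evaluate (leaf κ H isTree)))
      (sym (upd-same (memory s₄) (registers s 2))) max
    where
    below₄ : Below (memory s₄)
    below₄ i<B = trans (cong (λ M → M _) (trans mem₄ mem₃)) (below₂ i<B)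
    reads₄ : Reads (memory s) (registers s 0) (registers s₄ 1) rest
    reads₄ = subst (λ pos → Reads (memory s) (registers s 0) pos rest)
      (sym (trans r1₄ (trans r1₃ r1₂))) reads₁
    -- By `room`, the cell that receives the result has already been read.
    sp<r1 : registers s 2 < registers s₄ 1
    sp<r1 = ℕ.+-cancelʳ-≤ (length rest) _ _ (subst (suc (registers s 2) + length rest ≤_) (sym (reads-length rest reads₄)) room)
    sp<B : registers s 2 < registers s 0
    sp<B = ℕ.≤-trans (ℕ.m≤m+n _ (length rest)) room
    -- The parents found by pruning give the orientation that bounds the adjacency word by `3 * m`.
    -- The slopes 120, 220 and 34 add up to 374; the constant 44 is absorbed by `76 * m` below.
    bound : t₁ + t₂ + t₃ + t₄ ≤ (40 * (3 * m) + 4) + (110 * (m + m) + 4) + (34 * m + 4) + 8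
    bound = ℕ.+-mono-≤ (ℕ.+-mono-≤ (ℕ.+-mono-≤
      (ℕ.≤-trans t₁≤ (ℕ.+-monoˡ-≤ 4 (ℕ.*-monoʳ-≤ 40 (length-word≤ A par (Pruning.oriented pruning)))))
      t₂≤) (subst (λ l → t₃ ≤ 34 * l + 4) (List.length-tabulate (λ (i : Fin m) → i)) t₃≤)) t₄≤
    gather : ∀ a b c d → 3 + (4 + (2 + (a + (2 + (2 + (b + (2 + (2 + (c + (d + (3 + 4))))))))))) ≡ 24 + (a + b + c + d)
    gather = solve-∀
    total : ∀ m → 24 + ((40 * (3 * m) + 4) + (110 * (m + m) + 4) + (34 * m + 4) + 8) ≡ 44 * 1 + 374 * m
    total = solve-∀
    collect : ∀ m → 76 * m + 374 * m ≡ 450 * m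
    collect = solve-∀
    time = begin
      3 + (4 + (2 + (t₁ + (2 + (2 + (t₂ + (2 + (2 + (t₃ + (t₄ + (3 + 4)))))))))))  ≡⟨ gather t₁ t₂ t₃ t₄ ⟩
      24 + (t₁ + t₂ + t₃ + t₄)                                                  ≤⟨ ℕ.+-monoʳ-≤ 24 bound ⟩
      24 + ((40 * (3 * m) + 4) + (110 * (m + m) + 4) + (34 * m + 4) + 8)          ≡⟨ total m ⟩
      44 * 1 + 374 * m  ≤⟨ ℕ.+-monoˡ-≤ (374 * m) (ℕ.*-mono-≤ (from-yes (44 ≤? 76)) (1≤size (leaf κ H isTree))) ⟩
      76 * m + 374 * m  ≡⟨ collect m ⟩
      450 * m           ∎
      where open ℕ.≤-Reasoning

-- Evaluating the decomposition tree in postorder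

node-value : NodeKind → ℕ → ℕ → ℕ
node-value union k l = k + l
node-value join  k l = 1 ⊔ (k ⊔ l)

node-isMax : ∀ κ L R {k l} → IsMaxInducedMatchingSize (evaluate L) k → IsMaxInducedMatchingSize (evaluate R) l →
             IsMaxInducedMatchingSize (evaluate (node κ L R)) (node-value κ k l)
node-isMax union L R = ⊕-isMax {G = evaluate L} {evaluate R}
node-isMax join  L R = ⊗-isMax {G = evaluate L} {evaluate R} (someVertex L) (someVertex R)

node-run : ∀ κ {s sp} → registers s 8 ≡ nodeTag κ → registers s 2 ≡ suc (suc sp) →
  Run nodeProgram s 50 λ s′ → s′ ≡
    ⟨ registers s [ 2 ↦ suc sp ] ,
      memory s [ sp ↦ node-value κ (memory s sp) (memory s (suc sp)) ] ⟩
node-run union r8 r2 =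
  _ , _ , seq (assign= (cong (_∸ 1) r2)) (if-zero (cong (_∸ 2) r8) (store= refl refl)) , from-yes (19 ≤? 50) , refl
node-run join {s} {sp} r8 r2 =
  _ , _ , seq (assign= (cong (_∸ 1) r2)) (if-nonzero (λ z → contradiction (trans (sym (cong (_∸ 2) r8)) z) λ ())
    (store= refl (trans (m+[n∸m]≡m⊔n 1 (memory s sp + (memory s (suc sp) ∸ memory s sp))) (cong (1 ⊔_) (m+[n∸m]≡m⊔n (memory s sp) (memory s (suc sp))))))) ,
  from-yes (28 ≤? 50) , refl

-- The semantics describes only complete runs of the loop, while a subtree accounts for a segment of
-- one. A segment is therefore represented by what it does to every complete run that follows it.
record Pass (s : State) (t : ℕ) (s′ : State) : Set where
  field
    extend : ∀ {t′ s″} → mainLoop ∶ s′ ⇓[ t′ ] s″ → ∃ λ t″ → (mainLoop ∶ s ⇓[ t″ ] s″) × t″ ≤ t + t′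

open Pass

pass-trans : ∀ {s₁ s₂ s₃ t u} → Pass s₁ t s₂ → Pass s₂ u s₃ → Pass s₁ (t + u) s₃
extend (pass-trans {t = t} {u} p q) run with t₂ , run₂ , t₂≤ ← extend q run with t₁ , run₁ , t₁≤ ← extend p run₂ =
  t₁ , run₁ , ℕ.≤-trans t₁≤ (ℕ.≤-trans (ℕ.+-monoʳ-≤ t t₂≤) (ℕ.≤-reflexive (sym (ℕ.+-assoc t u _))))

-- As the reading position plus the unread length is the input length, `room` says that the stack
-- never passes the reading position. A leaf consumes at least two numbers and pushes one value; a
-- node consumes one number and shortens the stack by one.
record Ready (s : State) (rest : List ℕ) : Set where
  constructor ready
  field
    reads : Reads (memory s) (registers s 0) (registers s 1) rest
    room  : registers s 2 + length rest ≤ registers s 0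

record Evaluated (T : DecompositionTree) (rest : List ℕ) (s s′ : State) : Set where
  field
    ready′ : Ready s′ rest
    end    : registers s′ 0 ≡ registers s 0
    height : registers s′ 2 ≡ suc (registers s 2)
    stack  : ∀ {i} → i < registers s 2 → memory s′ i ≡ memory s i
    value  : IsMaxInducedMatchingSize (evaluate T) (memory s′ (registers s 2))

pass-body : ∀ {s x rest b s′} → Ready s (x ∷ rest) → mainBody ∶ s ⇓[ b ] s′ → Pass s (4 + b) s′
extend (pass-body {rest = rest} r run) run′ =
  _ , while-nonzero (ℕ.m>n⇒m∸n≢0 (reads-< rest (Ready.reads r))) run run′ , ℕ.≤-refl

-- The surplus of 500 per subtree pays for the node that combines two subtrees
-- and for the end of the program.
record Evaluation (T : DecompositionTree) (rest : List ℕ) (s : State) : Set where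
  field
    {time}    : ℕ
    {final}   : State
    pass      : Pass s time final
    evaluated : Evaluated T rest s final
    bound     : time + 500 ≤ 1000 * size T

-- The loop test, reading the tag and branching cost 15. Together with the surplus 500 this fits
-- into `550 * m`, whence the factor 1000.
leaf-bound : ∀ {m t} → 1 ≤ m → t ≤ 450 * m → 15 + t + 500 ≤ 1000 * m
leaf-bound {m} {t} 1≤m t≤ = begin
  15 + t + 500         ≡⟨ ℕ.+-comm (15 + t) 500 ⟩
  500 + (15 + t)       ≡⟨ ℕ.+-assoc 500 15 t ⟨
  515 + t              ≤⟨ ℕ.+-mono-≤ {515} {550 * m} {t} {450 * m} (ℕ.≤-trans (from-yes (515 ≤? 550)) (ℕ.*-monoʳ-≤ 550 1≤m)) t≤ ⟩
  550 * m + 450 * m    ≡⟨ ℕ.*-distribʳ-+ m 550 450 ⟨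
  1000 * m             ∎
  where open ℕ.≤-Reasoning

leaf-room : ∀ (ws rest : List ℕ) {h B} → h + suc (suc (length (ws ++ rest))) ≤ B → suc h + length rest ≤ B
leaf-room ws rest {h} {B} room = begin
  suc h + length rest                  ≡⟨ ℕ.+-suc h (length rest) ⟨
  h + suc (length rest)                ≤⟨ ℕ.+-monoʳ-≤ h (s≤s (ℕ.≤-trans (List.length-++-≤ʳ rest {ws}) (ℕ.n≤1+n _))) ⟩
  h + suc (suc (length (ws ++ rest)))  ≤⟨ room ⟩
  B                                    ∎
  where open ℕ.≤-Reasoning

evaluate-leaf : ∀ κ {m} {H : Graph (Fin m)} {isTree : IsTree H} (A : AdjacencyLists H) {rest s} →
  Ready s (leafTag κ ∷ m ∷ AdjacencyLists.word A ++ rest) → Evaluation (leaf κ H isTree) rest s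
evaluate-leaf κ {m} {H} {isTree} A {rest} {s} r@(ready (tag≡ , reads) room) =
  finish (leaf-run isTree A s₁ κ {rest} refl reads room′)
  where
  s₁ = ⟨ registers s [ 8 ↦ leafTag κ ] [ 1 ↦ suc (registers s 1) ] , memory s ⟩
  room′ : suc (registers s 2) + length rest ≤ registers s 0
  room′ = leaf-room (AdjacencyLists.word A) rest room
  leaf-tag : ∀ κ → leafTag κ ∸ 1 ≡ 0
  leaf-tag tree   = refl
  leaf-tag cotree = refl
  finish : Run leafProgram s₁ (450 * m) (LeafResult κ H isTree rest s₁) → Evaluation (leaf κ H isTree) rest s
  finish (t , s′ , run , t≤ , r0 , r2 , reads′ , stack , value) = record
    { pass      = pass-body r (seq (assign= tag≡) (seq (assign= (ℕ.+-comm (registers s 1) 1))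
        (if-zero (leaf-tag κ) run)))
    ; evaluated = record
        { ready′ = ready (subst (λ B → Reads (memory s′) B (registers s′ 1) rest) (sym r0) reads′)
            (subst₂ (λ h B → h + length rest ≤ B) (sym r2) (sym r0) room′)
        ; end    = r0
        ; height = r2
        ; stack  = stack
        ; value  = value
        }
    ; bound     = leaf-bound (1≤size (leaf κ H isTree)) t≤
    }

evaluate-node : ∀ κ L R {rest rest₁ s s₁ s₂} →
  Evaluated L rest₁ s s₁ → Evaluated R (nodeTag κ ∷ rest) s₁ s₂ →
  ∃₂ λ t s₃ → Pass s₂ t s₃ × Evaluated (node κ L R) rest s s₃ × t ≤ 500
evaluate-node κ L R {rest} {s = s} {s₁} {s₂} EL ER
  with t , _ , run , t≤ , refl ← node-run κ
    {⟨ registers s₂ [ 8 ↦ nodeTag κ ] [ 1 ↦ suc (registers s₂ 1) ] , memory s₂ ⟩} {registers s 2}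
    refl (trans (Evaluated.height ER) (cong suc (Evaluated.height EL))) =
  _ , _ ,
  pass-body (Evaluated.ready′ ER) (seq (assign= tag≡) (seq (assign= (ℕ.+-comm (registers s₂ 1) 1))
    (if-nonzero (node-tag κ) run))) ,
  record
    { ready′ = ready
        (reads-frame rest (λ pos≤ _ → upd-other (memory s₂) (ℕ.<⇒≢ (ℕ.≤-trans sp≤ pos≤) ∘ sym)) reads)
        (ℕ.≤-trans (ℕ.+-mono-≤ (ℕ.≤-trans (ℕ.n≤1+n _) (ℕ.≤-reflexive (sym height₂))) (ℕ.n≤1+n _)) room)
    ; end    = trans (end ER) (end EL)
    ; height = refl
    ; stack  = λ i< → trans (upd-other (memory s₂) (ℕ.<⇒≢ i<))
        (trans (stack ER (ℕ.≤-trans i< (ℕ.≤-trans (ℕ.n≤1+n _) (ℕ.≤-reflexive (sym (height EL)))))) (stack EL i<))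
    ; value  = subst (IsMaxInducedMatchingSize (evaluate (node κ L R))) (sym (upd-same (memory s₂) (registers s 2)))
        (node-isMax κ L R
          -- The right subtree was evaluated above the value of the left one, which is therefore
          -- still in its cell.
          (subst (IsMaxInducedMatchingSize (evaluate L)) (sym (stack ER (ℕ.≤-reflexive (sym (height EL))))) (value EL))
          (subst (IsMaxInducedMatchingSize (evaluate R)) (cong (memory s₂) (height EL)) (value ER)))
    } ,
  ℕ.≤-trans (ℕ.+-monoʳ-≤ 15 t≤) (from-yes (65 ≤? 500))
  where
  open Evaluated
  node-tag : ∀ κ → nodeTag κ ∸ 1 ≢ 0
  node-tag union ()
  node-tag join  ()
  tag≡ = proj₁ (Ready.reads (ready′ ER))
  reads = proj₂ (Ready.reads (ready′ ER))
  room = Ready.room (ready′ ER)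
  height₂ : registers s₂ 2 ≡ suc (suc (registers s 2))
  height₂ = trans (height ER) (cong suc (height EL))
  sp≤ : suc (registers s 2) ≤ suc (registers s₂ 1)
  sp≤ = ℕ.≤-trans (ℕ.≤-trans (ℕ.n≤1+n _) (ℕ.≤-reflexive (sym height₂)))
    (ℕ.≤-trans (ℕ.+-cancelʳ-≤ (suc (length rest)) _ _
      (subst (registers s₂ 2 + suc (length rest) ≤_) (sym (reads-length (nodeTag κ ∷ rest) (Ready.reads (ready′ ER)))) room))
      (ℕ.n≤1+n _))

node-bound : ∀ {t₁ t₂ t₃ m n} → t₁ + 500 ≤ 1000 * m → t₂ + 500 ≤ 1000 * n → t₃ ≤ 500 →
             t₁ + (t₂ + t₃) + 500 ≤ 1000 * (m + n)
node-bound {t₁} {t₂} {t₃} {m} {n} t₁≤ t₂≤ t₃≤ = begin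
  t₁ + (t₂ + t₃) + 500       ≤⟨ ℕ.+-monoˡ-≤ 500 (ℕ.+-monoʳ-≤ t₁ (ℕ.+-monoʳ-≤ t₂ t₃≤)) ⟩
  t₁ + (t₂ + 500) + 500      ≡⟨ ℕ.+-assoc t₁ (t₂ + 500) 500 ⟩
  t₁ + (t₂ + 500 + 500)      ≡⟨ cong (t₁ +_) (ℕ.+-comm (t₂ + 500) 500) ⟩
  t₁ + (500 + (t₂ + 500))    ≡⟨ ℕ.+-assoc t₁ 500 (t₂ + 500) ⟨
  t₁ + 500 + (t₂ + 500)      ≤⟨ ℕ.+-mono-≤ t₁≤ t₂≤ ⟩
  1000 * m + 1000 * n        ≡⟨ ℕ.*-distribˡ-+ 1000 m n ⟨
  1000 * (m + n)             ∎
  where open ℕ.≤-Reasoning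

evaluate-word : ∀ {w T} → w Encodes T → ∀ {rest s} → Ready s (w ++ rest) → Evaluation T rest s
evaluate-word (leaf κ A) r = evaluate-leaf κ A r
evaluate-word (node κ {L} {R} {u} {v} eL eR) {rest} {s} r
  with EL ← evaluate-word eL {(v ++ [ nodeTag κ ]) ++ rest} {s}
    (subst (Ready s) (List.++-assoc u (v ++ [ nodeTag κ ]) rest) r)
  with ER ← evaluate-word eR {nodeTag κ ∷ rest} {Evaluation.final EL}
    (subst (Ready (Evaluation.final EL)) (List.++-assoc v [ nodeTag κ ] rest) (Evaluated.ready′ (Evaluation.evaluated EL)))
  with t₃ , s₃ , pass₃ , E , t₃≤ ← evaluate-node κ L R (Evaluation.evaluated EL) (Evaluation.evaluated ER) =
  record
    { pass      = pass-trans (Evaluation.pass EL) (pass-trans (Evaluation.pass ER) pass₃)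
    ; evaluated = E
    ; bound     = node-bound {m = size L} {size R} (Evaluation.bound EL) (Evaluation.bound ER) t₃≤
    }

-- The last test of the main loop costs 4 and the output assignment 3; the surplus of the root pays
-- for both.
total-bound : ∀ {t t₁ m n} → t ≤ t₁ + 4 → t₁ + 500 ≤ 1000 * m → m ≤ n → t + 3 ≤ 1000 * n
total-bound {t} {t₁} {m} {n} t≤ t₁≤ m≤n = begin
  t + 3         ≤⟨ ℕ.+-monoˡ-≤ 3 t≤ ⟩
  t₁ + 4 + 3    ≡⟨ ℕ.+-assoc t₁ 4 3 ⟩
  t₁ + 7        ≤⟨ ℕ.+-monoʳ-≤ t₁ (from-yes (7 ≤? 500)) ⟩
  t₁ + 500      ≤⟨ t₁≤ ⟩
  1000 * m      ≤⟨ ℕ.*-monoʳ-≤ 1000 m≤n ⟩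
  1000 * n      ∎
  where open ℕ.≤-Reasoning

theorem5 : Σ[ p ∈ Program ] Σ[ c ∈ ℕ ]
    (∀ (n : ℕ) (G : Graph (Fin n)) → TreeCograph G →
    ∀ (T : DecompositionTree) → T IsDecompositionOf G →
    ∀ (w : List ℕ) → w Encodes T →
    ∃[ t ] ∃[ s ]
    ((p ∶ input w ⇓[ t ] s) × t ≤ c * n × IsMaxInducedMatchingSize G (output s)))
theorem5 = program , 1000 , λ n G _ T iso w enc →
  let initially = ready (reads-contents w (λ _ → refl) refl) ℕ.≤-refl
      V = evaluate-word enc {[]} {input w} (subst (Ready (input w)) (sym (List.++-identityʳ w)) initially)
      open Evaluation V
      open Evaluated evaluated
      -- With nothing left to read, `Reads` says that the reading position equals the input length,
      -- so the loop condition is 0.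
      stop = trans (cong (registers final 0 ∸_) (Ready.reads ready′)) (ℕ.n∸n≡0 (registers final 0))
      t , run , t≤ = extend pass (while-zero stop)
  in t + 3 , _ , seq run assign , total-bound {m = size T} t≤ bound (size≤ {T = T} iso) , ≅-isMax iso value
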